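{- Let $G$ be a 4-connected plane graph. Then $G$ is cleavable if and only if $G$ has at most one large face (i.e., if and only if $G$ is a near triangulation).
   Context: For a connected graph $G=(V,E)$, a cut is a set $S\subset V$ such that $G-S$ is disconnected; it is minimal if $G-T$ is connected for every proper subset $T\subset S$. A cut $S$ is connected if the induced subgraph $G[S]$ is connected. $G$ is cleavable if every minimal cut of $G$ is connected. In a 2-connected plane graph every face is bounded by a cycle; a large face is a face whose bounding cycle has length at least 4. A near triangulation is a 2-connected plane graph with at most one large face. -}

module Defs where

open import Data.Nat using (ℕ; zero; suc; _+_; _*_; _≤_; _<_)
open import Data.Fin using (Fin; toℕ)
open import Data.Fin.Subset using (Subset; _∈_; _∉_; _⊂_; ∁; ∣_∣)
open import Data.Fin.Properties using (any?; all?; _≟_)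
open import Data.Nat.Properties using (_<?_)
open import Data.Nat.DivMod using (_/_)
open import Relation.Nullary.Decidable using (_→-dec_; ¬?)
open import Data.List using (List; length; filter)
open import Data.List using () renaming (allFin to listFin)
open import Data.Product using (Σ; ∃; _×_; _,_)
open import Relation.Nullary using (¬_; Dec)
open import Relation.Unary using (Pred; Decidable)
import Agda.Primitive
open import Relation.Binary.PropositionalEquality using (_≡_; _≢_)

iter : ∀ {A : Set} → (A → A) → ℕ → A → A
iter f zero    x = x
iter f (suc k) x = f (iter f k x)

count : ∀ {d} {P : Pred (Fin d) Agda.Primitive.lzero} → Decidable P → ℕ
count {d} P? = length (filter P? (listFin d))

-- Plane graphs as (genus 0) combinatorial maps / rotation systems.
--
-- Vertices are Fin n.  Darts (half-edges, i.e. oriented edges) are Fin d.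
--   tail x : the vertex the dart x starts at
--   rev x  : the reversed dart (the other half of the same edge)
--   rot x  : the next dart around the vertex tail x in the clockwise
--            rotation at that vertex (a cyclic order of the darts at it)
-- Faces are the orbits of the face-tracing permutation  face = rot ∘ rev.
-- The graph is simple (no loops, no parallel edges) and the embedding is
-- in the sphere, expressed by Euler's formula  V - E + F = 2
-- (with E = d/2, which is exact since rev is a fixed-point-free involution).

record Map (n : ℕ) : Set where
  field
    d       : ℕ
    tail    : Fin d → Fin n
    rev     : Fin d → Fin d
    rot     : Fin d → Fin d
    rot⁻¹   : Fin d → Fin d
    rev-inv : ∀ x → rev (rev x) ≡ x
    rev-fp  : ∀ x → rev x ≢ x
    rot-inv₁ : ∀ x → rot (rot⁻¹ x) ≡ x
    rot-inv₂ : ∀ x → rot⁻¹ (rot x) ≡ x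
    rot-tail : ∀ x → tail (rot x) ≡ tail x
    rot-trans : ∀ x y → tail x ≡ tail y → Σ ℕ λ k → iter rot k x ≡ y
    no-loop  : ∀ x → tail (rev x) ≢ tail x
    no-multi : ∀ x y → tail x ≡ tail y → tail (rev x) ≡ tail (rev y) → x ≡ y

  face : Fin d → Fin d
  face x = rot (rev x)

  SameFace : Fin d → Fin d → Set
  SameFace x y = Σ (Fin d) λ k → iter face (toℕ k) x ≡ y

  SameFace? : ∀ x → Decidable (SameFace x)
  SameFace? x y = any? (λ k → iter face (toℕ k) x ≟ y)

  faceLength : Fin d → ℕ
  faceLength x = count (SameFace? x)

  LargeFace : Fin d → Set
  LargeFace x = 4 ≤ faceLength x

  -- darts that are the least dart of their face: exactly one per face
  FaceRep : Fin d → Set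
  FaceRep x = ∀ (y : Fin d) → toℕ y < toℕ x → ¬ SameFace x y

  FaceRep? : Decidable FaceRep
  FaceRep? x = all? (λ y → (toℕ y <? toℕ x) →-dec ¬? (SameFace? x y))

  numFaces : ℕ
  numFaces = count FaceRep?

  numEdges : ℕ
  numEdges = d / 2

  Adj : Fin n → Fin n → Set
  Adj u v = Σ (Fin d) λ x → tail x ≡ u × tail (rev x) ≡ v

  data Reach (X : Subset n) : Fin n → Fin n → Set where
    here  : ∀ {u} → u ∈ X → Reach X u u
    step  : ∀ {u w v} → u ∈ X → Adj u w → Reach X w v → Reach X u v

  Connected : Subset n → Set
  Connected X = ∀ u v → u ∈ X → v ∈ X → Reach X u v

  IsCut : Subset n → Set
  IsCut S = ¬ Connected (∁ S)

  IsMinimalCut : Subset n → Set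
  IsMinimalCut S = IsCut S × (∀ T → T ⊂ S → ¬ IsCut T)

  Cleavable : Set
  Cleavable = ∀ S → IsMinimalCut S → Connected S

  KConnected : ℕ → Set
  KConnected k = k < n × (∀ S → ∣ S ∣ < k → Connected (∁ S))

  AtMostOneLargeFace : Set
  AtMostOneLargeFace = ∀ x y → LargeFace x → LargeFace y → SameFace x y

record PlaneGraph (n : ℕ) : Set where
  field
    map   : Map n
  open Map map public
  field
    euler : n + numFaces ≡ 2 + numEdges

{-# OPTIONS --safe #-}

-- Cochains are antisymmetric integer functions on darts.  On a connected map satisfying Euler's formula, linear
-- algebra over ℤ shows that a multiple of every cochain summing to zero around faces is a vertex coboundary, and
-- that a multiple of every cycle is the boundary of a face function; the latter replaces the Jordan curve theorem.
--
-- (⇐) Suppose a minimal cut S has a component A missing b ∈ S, and let C, D be components of G − S. The cochain of the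
-- edges from C to A sums to zero around triangles, hence around all faces, so it is a coboundary up to scaling.
-- Following its potential around a closed walk through C, A, D, b and back to C gives a contradiction.
--
-- (⇒) Two large faces are joined by four disjoint paths (Menger), P₀, P₁, P₂, P₃ in the order of their ends on one
-- face. By planarity P₁ ∪ P₃ separates P₀ from P₂ and there is no edge between P₁ and P₃. A minimal separator of
-- P₀ and P₂ inside P₁ ∪ P₃ meets both, so it is not connected; it is a minimal cut, because a third component of its
-- complement would produce a K₃,₃ minor.
module Submission where

open import Defs
open import Data.Nat using (ℕ)
open import Function.Bundles using (_⇔_; mk⇔)
open import Data.Bool.Base using (true; false)
open import Data.Empty using (⊥; ⊥-elim)
open import Data.Fin.Base as Fin using (Fin; zero; suc; toℕ; fromℕ<; splitAt; _↑ˡ_; _↑ʳ_)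
open import Data.Fin.Permutation using (permutation)
import Data.Fin.Properties as Fin
open import Data.Fin.Subset as Subset using (Subset; ∁; ⁅_⁆; _∪_; ∣_∣) renaming (_∈_ to _∈ₛ_; _∉_ to _∉ₛ_)
import Data.Fin.Subset.Properties as Subset
open import Data.Integer.Base as ℤ using (ℤ; 0ℤ; 1ℤ; +_; -[1+_]; _+_; _*_; _-_; -_)
import Data.Integer.Properties as ℤ
open import Data.Integer.Tactic.RingSolver using (solve-∀)
open import Data.List.Base using (List; []; _∷_; _++_; length; map; filter; allFin; lookup; tabulate)
open import Data.List.Membership.Propositional using (_∈_; _∉_)
open import Data.List.Membership.Propositional.Properties using (∈-filter⁺; ∈-filter⁻; ∈-allFin; ∈-lookup; ∈-map⁻; ∈-map⁺; ∈-tabulate⁺)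
open import Data.List.Properties using (length-map; length-++; length-tabulate)
open import Data.List.Relation.Unary.All as All using (All; []; _∷_)
import Data.List.Relation.Unary.All.Properties as All
open import Data.List.Relation.Unary.AllPairs using (AllPairs; []; _∷_)
open import Data.List.Relation.Unary.Any using (here; there; index; any?)
open import Data.List.Relation.Unary.Any.Properties using (lookup-index)
open import Data.List.Relation.Unary.Unique.Propositional using (Unique)
import Data.List.Relation.Unary.Unique.Propositional.Properties as Unique
open import Data.Nat.Base as ℕ using (zero; suc; z≤n; s≤s)
import Data.Nat.DivMod as ℕ
open import Data.Nat.Induction using (<-rec)
import Data.Nat.Properties as ℕ
open import Data.Product using (Σ; ∃; _×_; _,_; proj₁; proj₂)
open import Data.Sum using (_⊎_; inj₁; inj₂; [_,_]′)
open import Data.Unit using (⊤; tt)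
open import Data.Vec.Base using () renaming (_∷_ to _∷ᵥ_; there to thereᵥ; tabulate to tabulateᵥ)
open import Data.Vec.Properties using (lookup∘tabulate; []=⇒lookup; lookup⇒[]=)
open import Function.Base using (_∘_; id; case_of_)
open import Relation.Binary.Definitions using (tri<; tri≈; tri>)
open import Relation.Binary.PropositionalEquality
open import Relation.Nullary using (¬_; Dec; yes; no; does; ¬?)
open import Relation.Nullary.Decidable using (_→-dec_; _×-dec_; _⊎-dec_)
open import Relation.Nullary.Negation using (contradiction)
open import Relation.Unary using (Decidable)
open import Algebra.Properties.Semiring.Sum ℤ.+-*-semiring using (sum; sum-cong-≗; sum-replicate-zero; ∑-distrib-+; *-distribˡ-sum; sum-permute)

open ≡-Reasoning

-- Linear systems over the integers

-- Genus zero enters through a count: Euler's formula leaves one more unknown than equations in the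
-- linear system of `hodge`. Everything topological is then read off a face function `g` bounded by
-- a closed walk. Along a walk disjoint from the closed walk `g` is constant; turning past a dart of
-- the closed walk changes it by a fixed positive amount. Two walks that ought to end on different
-- sides of the curve but lead to the same face therefore give an equation `a ≡ a + c`. The closed
-- walks need not be simple, because jumps of `g` are evaluated only at vertices that the rest of
-- the walk avoids. Nothing is ever divided, which is why all conclusions concern a multiple
-- `c * ω`; positivity of the inner product over the integers does the work of an orthogonal
-- projection. Menger's theorem is obtained under a double negation, which suffices because it is
-- used to derive a contradiction.

module Summation where
  abstract
    ∑ : ∀ {m} → (Fin m → ℤ) → ℤ
    ∑ f = sum f

    ∑-suc : ∀ {m} (f : Fin (suc m) → ℤ) → ∑ f ≡ f zero + ∑ (λ i → f (suc i))
    ∑-suc f = refl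

    ∑-cong : ∀ {m} {f g : Fin m → ℤ} → (∀ i → f i ≡ g i) → ∑ f ≡ ∑ g
    ∑-cong = sum-cong-≗

    ∑-zero : ∀ {m} {f : Fin m → ℤ} → (∀ i → f i ≡ 0ℤ) → ∑ f ≡ 0ℤ
    ∑-zero {m} f≗0 = trans (sum-cong-≗ f≗0) (sum-replicate-zero m)

    ∑-+ : ∀ {m} (f g : Fin m → ℤ) → ∑ (λ i → f i + g i) ≡ ∑ f + ∑ g
    ∑-+ = ∑-distrib-+

    ∑-* : ∀ {m} c (f : Fin m → ℤ) → ∑ (λ i → c * f i) ≡ c * ∑ f
    ∑-* c f = sym (*-distribˡ-sum c f)

    ∑-reindex : ∀ {m} (σ σ⁻¹ : Fin m → Fin m) → (∀ i → σ (σ⁻¹ i) ≡ i) → (∀ i → σ⁻¹ (σ i) ≡ i) →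
      ∀ (f : Fin m → ℤ) → ∑ (λ i → f (σ i)) ≡ ∑ f
    ∑-reindex σ σ⁻¹ invˡ invʳ f = sym (sum-permute f (permutation σ σ⁻¹ invˡ invʳ))

open Summation

∑-neg : ∀ {m} (f : Fin m → ℤ) → ∑ (λ i → - f i) ≡ - ∑ f
∑-neg f = begin
  ∑ (λ i → - f i)          ≡⟨ ∑-cong (λ i → ℤ.-1*i≡-i (f i)) ⟨
  ∑ (λ i → ℤ.-1ℤ * f i)    ≡⟨ ∑-* ℤ.-1ℤ f ⟩
  ℤ.-1ℤ * ∑ f              ≡⟨ ℤ.-1*i≡-i (∑ f) ⟩
  - ∑ f                    ∎

∑-- : ∀ {m} (f g : Fin m → ℤ) → ∑ (λ i → f i - g i) ≡ ∑ f - ∑ g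
∑-- f g = trans (∑-+ f (λ i → - g i)) (cong (_+_ (∑ f)) (∑-neg g))

dot : ∀ {m} → (Fin m → ℤ) → (Fin m → ℤ) → ℤ
dot a x = ∑ (λ i → a i * x i)

pivot : ∀ {A : Set} {P : A → Set} → (∀ a → Dec (P a)) → (rows : List A) →
  All P rows ⊎ (∃ λ xs → ∃ λ r → ∃ λ ys → rows ≡ xs ++ r ∷ ys × ¬ P r)
pivot P? [] = inj₁ []
pivot P? (r ∷ rows) with P? r
... | no ¬p = inj₂ ([] , r , rows , refl , ¬p)
... | yes p with pivot P? rows
...   | inj₁ ps = inj₁ (p ∷ ps)
...   | inj₂ (xs , r′ , ys , refl , ¬p) = inj₂ (r ∷ xs , r′ , ys , refl , ¬p)

module _ {m} (r : Fin (suc m) → ℤ) where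

  -- Fraction-free Gaussian elimination: cross-multiplying by the two leading coefficients cancels
  -- the first unknown without leaving the integers.
  eliminate : (Fin (suc m) → ℤ) → Fin m → ℤ
  eliminate a i = r zero * a (suc i) - a zero * r (suc i)

  private
    r·_ : (Fin m → ℤ) → ℤ
    r· y = ∑ (λ i → r (suc i) * y i)

  -- Back substitution without division: the other unknowns are scaled by `r zero`, so that the
  -- pivot equation determines the first one.
  extend : (Fin m → ℤ) → Fin (suc m) → ℤ
  extend y zero    = - (r· y)
  extend y (suc i) = r zero * y i

  private
    pull : ∀ y (a : Fin (suc m) → ℤ) → dot a (extend y) ≡ a zero * - (r· y) + r zero * ∑ (λ i → a (suc i) * y i)
    pull y a = trans (∑-suc _) (cong (_+_ (a zero * - (r· y))) (begin
      ∑ (λ i → a (suc i) * (r zero * y i))  ≡⟨ ∑-cong (λ i → swap (a (suc i)) (r zero) (y i)) ⟩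
      ∑ (λ i → r zero * (a (suc i) * y i))  ≡⟨ ∑-* (r zero) (λ i → a (suc i) * y i) ⟩
      r zero * ∑ (λ i → a (suc i) * y i)    ∎))
      where
      swap : ∀ p q s → p * (q * s) ≡ q * (p * s)
      swap = solve-∀

  extend-pivot : ∀ y → dot r (extend y) ≡ 0ℤ
  extend-pivot y = trans (pull y r) (cancel (r zero) (r· y))
    where
    cancel : ∀ p q → p * - q + p * q ≡ 0ℤ
    cancel = solve-∀

  extend-eliminate : ∀ y a → dot (eliminate a) y ≡ 0ℤ → dot a (extend y) ≡ 0ℤ
  extend-eliminate y a eq = begin
    dot a (extend y)                                    ≡⟨ pull y a ⟩
    a zero * - (r· y) + r zero * s                      ≡⟨ regroup (a zero) (r· y) (r zero * s) ⟩
    r zero * s - a zero * (r· y)                        ≡⟨ cong₂ _-_ (∑-* (r zero) _) (∑-* (a zero) _) ⟨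
    ∑ (λ i → r zero * (a (suc i) * y i)) - ∑ (λ i → a zero * (r (suc i) * y i))
      ≡⟨ ∑-- (λ i → r zero * (a (suc i) * y i)) (λ i → a zero * (r (suc i) * y i)) ⟨
    ∑ (λ i → r zero * (a (suc i) * y i) - a zero * (r (suc i) * y i))
      ≡⟨ ∑-cong (λ i → factor (r zero) (a (suc i)) (y i) (a zero) (r (suc i))) ⟩
    dot (eliminate a) y                                 ≡⟨ eq ⟩
    0ℤ                                                  ∎
    where
    s = ∑ (λ i → a (suc i) * y i)
    regroup : ∀ p q t → p * - q + t ≡ t - p * q
    regroup = solve-∀
    factor : ∀ p q s t u → p * (q * s) - t * (u * s) ≡ (p * q - t * u) * s
    factor = solve-∀

-- Induction on the number of unknowns. If no row involves the first unknown, the first unit vector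
-- is a solution. Otherwise one row serves as pivot and is eliminated; the extended solution stays
-- nonzero because `r zero` is nonzero and the integers have no zero divisors.
solution : ∀ {m} (rows : List (Fin m → ℤ)) → length rows ℕ.< m →
  ∃ λ (x : Fin m → ℤ) → (∃ λ j → x j ≢ 0ℤ) × All (λ a → dot a x ≡ 0ℤ) rows
solution {suc m} rows lt with pivot (λ a → a zero ℤ.≟ 0ℤ) rows
... | inj₁ zeros = e , (zero , λ ()) , All.map (λ {a} → vanish a) zeros
  where
  e : Fin (suc m) → ℤ
  e zero    = 1ℤ
  e (suc _) = 0ℤ
  vanish : ∀ (a : Fin (suc m) → ℤ) → a zero ≡ 0ℤ → dot a e ≡ 0ℤ
  vanish a a₀≡0 = ∑-zero λ where
    zero    → cong (_* 1ℤ) a₀≡0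
    (suc i) → ℤ.*-zeroʳ (a (suc i))
... | inj₂ (xs , r , ys , refl , r₀≢0) = extended (solution (map (eliminate r) (xs ++ ys)) shorter)
  where
  shorter : length (map (eliminate r) (xs ++ ys)) ℕ.< m
  shorter = ℕ.≤-trans (ℕ.≤-reflexive (begin
    suc (length (map (eliminate r) (xs ++ ys))) ≡⟨ cong suc (trans (length-map (eliminate r) (xs ++ ys)) (length-++ xs)) ⟩
    suc (length xs ℕ.+ length ys)               ≡⟨ ℕ.+-suc (length xs) (length ys) ⟨
    length xs ℕ.+ suc (length ys)               ≡⟨ length-++ xs ⟨
    length (xs ++ r ∷ ys)                       ∎)) (ℕ.≤-pred lt)

  extended : (∃ λ (y : Fin m → ℤ) → (∃ λ j → y j ≢ 0ℤ) × All (λ a → dot a y ≡ 0ℤ) (map (eliminate r) (xs ++ ys))) →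
    ∃ λ (x : Fin (suc m) → ℤ) → (∃ λ j → x j ≢ 0ℤ) × All (λ a → dot a x ≡ 0ℤ) (xs ++ r ∷ ys)
  extended (y , (j , yⱼ≢0) , kills)
    = extend r y
    , (suc j , λ eq → [ r₀≢0 , yⱼ≢0 ]′ (ℤ.i*j≡0⇒i≡0∨j≡0 (r zero) eq))
    , All.++⁺ (All.map (λ {a} → extend-eliminate r y a) (All.++⁻ˡ xs kills′))
              (extend-pivot r y ∷ All.map (λ {a} → extend-eliminate r y a) (All.++⁻ʳ xs kills′))
    where kills′ = All.map⁻ kills

square : ∀ i → ∃ λ k → i * i ≡ + k × (k ≡ 0 → i ≡ 0ℤ)
square (+ zero)  = 0 , refl , λ _ → refl
square (+ suc n) = _ , refl , λ ()
square -[1+ n ]  = _ , refl , λ ()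

-- Positive definiteness of the dot product. The sum is produced as a natural number, where a
-- vanishing sum has vanishing summands.
∑-squares : ∀ {m} (f : Fin m → ℤ) → ∃ λ k → ∑ (λ i → f i * f i) ≡ + k × (k ≡ 0 → ∀ i → f i ≡ 0ℤ)
∑-squares {zero}  f = 0 , ∑-zero (λ ()) , λ _ ()
∑-squares {suc m} f 
  with k , ∑≡k , zeros ← ∑-squares (λ i → f (suc i))
  with k₀ , sq≡k₀ , zero₀ ← square (f zero)
  = k₀ ℕ.+ k , trans (∑-suc _) (cong₂ _+_ sq≡k₀ ∑≡k) , λ where
    eq zero    → zero₀ (ℕ.m+n≡0⇒m≡0 k₀ eq)
    eq (suc i) → zeros (ℕ.m+n≡0⇒n≡0 k₀ eq) i

∑-squares≡0 : ∀ {m} (f : Fin m → ℤ) → ∑ (λ i → f i * f i) ≡ 0ℤ → ∀ i → f i ≡ 0ℤ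
∑-squares≡0 f eq with k , ∑≡k , zeros ← ∑-squares f = zeros (ℤ.+-injective (trans (sym ∑≡k) eq))

δ : ∀ {m} → Fin m → Fin m → ℤ
δ zero    zero    = 1ℤ
δ zero    (suc j) = 0ℤ
δ (suc i) zero    = 0ℤ
δ (suc i) (suc j) = δ i j

δ-refl : ∀ {m} (i : Fin m) → δ i i ≡ 1ℤ
δ-refl zero    = refl
δ-refl (suc i) = δ-refl i

δ-≢ : ∀ {m} {i j : Fin m} → i ≢ j → δ i j ≡ 0ℤ
δ-≢ {i = zero}  {zero}  i≢j = ⊥-elim (i≢j refl)
δ-≢ {i = zero}  {suc j} i≢j = refl
δ-≢ {i = suc i} {zero}  i≢j = refl
δ-≢ {i = suc i} {suc j} i≢j = δ-≢ (i≢j ∘ cong suc)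

∑-δ : ∀ {m} (i : Fin m) (f : Fin m → ℤ) → ∑ (λ j → δ i j * f j) ≡ f i
∑-δ zero f = begin
  ∑ (λ j → δ zero j * f j)               ≡⟨ ∑-suc _ ⟩
  1ℤ * f zero + ∑ (λ j → 0ℤ * f (suc j)) ≡⟨ cong₂ _+_ (ℤ.*-identityˡ (f zero)) (∑-zero (λ _ → refl)) ⟩
  f zero + 0ℤ                            ≡⟨ ℤ.+-identityʳ _ ⟩
  f zero                                 ∎
∑-δ (suc i) f = begin
  ∑ (λ j → δ (suc i) j * f j)               ≡⟨ ∑-suc _ ⟩
  0ℤ + ∑ (λ j → δ i j * f (suc j))          ≡⟨ ℤ.+-identityˡ _ ⟩
  ∑ (λ j → δ i j * f (suc j))               ≡⟨ ∑-δ i (λ j → f (suc j)) ⟩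
  f (suc i)                                 ∎

-- Counting by injections

injection-length : ∀ {A : Set} {m} (L : List A) (f : Fin m → A) → (∀ i → f i ∈ L) →
  (∀ {i j} → f i ≡ f j → i ≡ j) → m ℕ.≤ length L
injection-length L f f∈L f-inj = Fin.injective⇒≤ {f = λ i → index (f∈L i)} λ {i} {j} eq → f-inj (begin
  f i                          ≡⟨ lookup-index (f∈L i) ⟩
  lookup L (index (f∈L i))     ≡⟨ cong (lookup L) eq ⟩
  lookup L (index (f∈L j))     ≡⟨ lookup-index (f∈L j) ⟨
  f j                          ∎)

length-filter-¬ : ∀ {A : Set} {P : A → Set} (P? : Decidable P) (xs : List A) →
  length (filter P? xs) ℕ.+ length (filter (¬? ∘ P?) xs) ≡ length xs
length-filter-¬ P? [] = refl
length-filter-¬ P? (x ∷ xs) with P? x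
... | yes _ = cong suc (length-filter-¬ P? xs)
... | no  _ = trans (ℕ.+-suc _ _) (cong suc (length-filter-¬ P? xs))

count-¬ : ∀ {d} {P : Fin d → Set} (P? : Decidable P) → count P? ℕ.+ count (¬? ∘ P?) ≡ d
count-¬ {d} P? = trans (length-filter-¬ P? (allFin d)) (length-tabulate id)

lookup-injective : ∀ {A : Set} {xs : List A} → Unique xs → ∀ i j → lookup xs i ≡ lookup xs j → i ≡ j
lookup-injective (x∉ ∷ u) zero    zero    eq = refl
lookup-injective (x∉ ∷ u) zero    (suc j) eq = ⊥-elim (All.lookup x∉ (∈-lookup j) eq)
lookup-injective (x∉ ∷ u) (suc i) zero    eq = ⊥-elim (All.lookup x∉ (∈-lookup i) (sym eq))
lookup-injective (x∉ ∷ u) (suc i) (suc j) eq = cong suc (lookup-injective u i j eq)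

count-lookup : ∀ {d} {P : Fin d → Set} (P? : Decidable P) → Fin (count P?) → Fin d
count-lookup {d} P? = lookup (filter P? (allFin d))

count-lookup-holds : ∀ {d} {P : Fin d → Set} (P? : Decidable P) i → P (count-lookup P? i)
count-lookup-holds {d} P? i = proj₂ (∈-filter⁻ P? {xs = allFin d} (∈-lookup i))

count-lookup-injective : ∀ {d} {P : Fin d → Set} (P? : Decidable P) {i j} →
  count-lookup P? i ≡ count-lookup P? j → i ≡ j
count-lookup-injective {d} P? {i} {j} = lookup-injective (Unique.filter⁺ P? (Unique.allFin⁺ d)) i j

injection-count : ∀ {d m} {P : Fin d → Set} (P? : Decidable P) (f : Fin m → Fin d) → (∀ i → P (f i)) →
  (∀ {i j} → f i ≡ f j → i ≡ j) → m ℕ.≤ count P?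
injection-count {d} P? f Pf = injection-length (filter P? (allFin d)) f λ i → ∈-filter⁺ P? (∈-allFin (f i)) (Pf i)

-- Orbits of an injective self-map of a finite set

module _ {A : Set} (f : A → A) where

  iter-+ : ∀ k l x → iter f (k ℕ.+ l) x ≡ iter f k (iter f l x)
  iter-+ zero    l x = refl
  iter-+ (suc k) l x = cong f (iter-+ k l x)

  iter-injective : (∀ {x y} → f x ≡ f y → x ≡ y) → ∀ k {x y} → iter f k x ≡ iter f k y → x ≡ y
  iter-injective f-inj zero    eq = eq
  iter-injective f-inj (suc k) eq = iter-injective f-inj k (f-inj eq)

  iter-cancel : (∀ {x y} → f x ≡ f y → x ≡ y) → ∀ {i j} x → i ℕ.≤ j → iter f i x ≡ iter f j x → iter f (j ℕ.∸ i) x ≡ x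
  iter-cancel f-inj {i} {j} x i≤j eq = iter-injective f-inj i (begin
    iter f i (iter f (j ℕ.∸ i) x) ≡⟨ iter-+ i (j ℕ.∸ i) x ⟨
    iter f (i ℕ.+ (j ℕ.∸ i)) x    ≡⟨ cong (λ k → iter f k x) (ℕ.m+[n∸m]≡n i≤j) ⟩
    iter f j x                    ≡⟨ eq ⟨
    iter f i x                    ∎)

module _ {d} (f : Fin d → Fin d) (f-inj : ∀ {x y} → f x ≡ f y → x ≡ y) where

  iter-return : ∀ x → ∃ λ p → p ℕ.< d × iter f (suc p) x ≡ x
  iter-return x
    with i , j , i<j , eq ← Fin.pigeonhole (ℕ.n<1+n d) (λ (k : Fin (suc d)) → iter f (toℕ k) x)
    with toℕ j ℕ.∸ toℕ i in gap | iter-cancel f f-inj x (ℕ.<⇒≤ i<j) eq | ℕ.m∸n≤m (toℕ j) (toℕ i)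
  ... | zero  | _      | _ = ⊥-elim (ℕ.<⇒≱ i<j (ℕ.m∸n≡0⇒m≤n gap))
  ... | suc p | return | p<j = p , ℕ.≤-trans p<j (Fin.toℕ≤pred[n] j) , return

  iter-reduce : ∀ {p x} → iter f (suc p) x ≡ x → ∀ k → ∃ λ l → l ℕ.≤ p × iter f l x ≡ iter f k x
  iter-reduce return zero = zero , z≤n , refl
  iter-reduce {p} return (suc k) with l , l≤p , eq ← iter-reduce return k with l ℕ.≟ p
  ... | yes refl = zero , z≤n , trans (sym return) (cong f eq)
  ... | no l≢p = suc l , ℕ.≤∧≢⇒< l≤p l≢p , cong f eq

  -- The exponent is reduced modulo a period of at most `d`. Hence `SameFace`, whose exponents range
  -- over `Fin d`, captures the whole orbit.
  iter-bounded : ∀ k x → ∃ λ (l : Fin d) → iter f (toℕ l) x ≡ iter f k x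
  iter-bounded k x
    with p , p<d , return ← iter-return x
    with l , l≤p , eq ← iter-reduce return k
    = fromℕ< l<d , trans (cong (λ i → iter f i x) (Fin.toℕ-fromℕ< l<d)) eq
    where l<d = ℕ.≤-<-trans l≤p p<d

-- Maps

data Conn {V : Set} (R : V → V → Set) (Q : V → Set) : V → V → Set where
  end : ∀ {u} → Q u → Conn R Q u u
  hop : ∀ {u w v} → Q u → R u w → Conn R Q w v → Conn R Q u v

module _ {V : Set} {R : V → V → Set} where

  infixr 5 _++ᶜ_
  _++ᶜ_ : ∀ {Q : V → Set} {u v w} → Conn R Q u v → Conn R Q v w → Conn R Q u w
  end _       ++ᶜ q = q
  hop qu r p  ++ᶜ q = hop qu r (p ++ᶜ q)

  Conn-source : ∀ {Q : V → Set} {u v} → Conn R Q u v → Q u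
  Conn-source (end q)     = q
  Conn-source (hop q _ _) = q

  Conn-target : ∀ {Q : V → Set} {u v} → Conn R Q u v → Q v
  Conn-target (end q)     = q
  Conn-target (hop _ _ p) = Conn-target p

  Conn-sym : (∀ {u v} → R u v → R v u) → ∀ {Q : V → Set} {u v} → Conn R Q u v → Conn R Q v u
  Conn-sym R-sym (end q)     = end q
  Conn-sym R-sym (hop q r p) = Conn-sym R-sym p ++ᶜ hop (Conn-source p) (R-sym r) (end q)

Conn-map : ∀ {V : Set} {R R′ : V → V → Set} → (∀ {u v} → R u v → R′ u v) → ∀ {Q Q′ : V → Set} →
  (∀ {w} → Q w → Q′ w) → ∀ {u v} → Conn R Q u v → Conn R′ Q′ u v
Conn-map f h (end q)     = end (h q)
Conn-map f h (hop q r p) = hop (h q) (f r) (Conn-map f h p)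

module MapProperties {n} (M : Map n) where
  open Map M

  head : Fin d → Fin n
  head x = tail (rev x)

  head-rev : ∀ x → head (rev x) ≡ tail x
  head-rev x = cong tail (rev-inv x)

  Adj-sym : ∀ {u v} → Adj u v → Adj v u
  Adj-sym (x , tx , hx) = rev x , hx , trans (head-rev x) tx

  face⁻¹ : Fin d → Fin d
  face⁻¹ x = rev (rot⁻¹ x)

  face-face⁻¹ : ∀ x → face (face⁻¹ x) ≡ x
  face-face⁻¹ x = trans (cong rot (rev-inv _)) (rot-inv₁ x)

  face⁻¹-face : ∀ x → face⁻¹ (face x) ≡ x
  face⁻¹-face x = trans (cong rev (rot-inv₂ _)) (rev-inv x)

  face-injective : ∀ {x y} → face x ≡ face y → x ≡ y
  face-injective {x} {y} eq = trans (sym (face⁻¹-face x)) (trans (cong face⁻¹ eq) (face⁻¹-face y))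

  face-rev : ∀ x → face (rev x) ≡ rot x
  face-rev x = cong rot (rev-inv x)

  tail-face : ∀ x → tail (face x) ≡ head x
  tail-face x = rot-tail (rev x)

  sameFace : ∀ k {x y} → iter face k x ≡ y → SameFace x y
  sameFace k {x} eq with l , eq′ ← iter-bounded face face-injective k x = l , trans eq′ eq

  SameFace-face : ∀ x → SameFace x (face x)
  SameFace-face x = sameFace 1 refl

  SameFace-trans : ∀ {x y z} → SameFace x y → SameFace y z → SameFace x z
  SameFace-trans {x} (k , refl) (l , refl) = sameFace (toℕ l ℕ.+ toℕ k) (iter-+ face (toℕ l) (toℕ k) x)

  SameFace-sym : ∀ {x y} → SameFace x y → SameFace y x
  SameFace-sym {x} (k , refl) = back (toℕ k)
    where
    back : ∀ k → SameFace (iter face k x) x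
    back zero    = sameFace 0 refl
    back (suc k) with p , _ , return ← iter-return face face-injective (iter face k x) =
      SameFace-trans (sameFace p (trans (sym (iter-+ face p 1 (iter face k x))) (trans (cong (λ l → iter face l (iter face k x)) (ℕ.+-comm p 1)) return))) (back k)

  FaceInvariant VertexInvariant Antisymmetric : (Fin d → ℤ) → Set
  FaceInvariant g   = ∀ x → g (face x) ≡ g x
  VertexInvariant g = ∀ x → g (rot x) ≡ g x
  Antisymmetric ω   = ∀ x → ω (rev x) ≡ - ω x

  FaceInvariant-SameFace : ∀ {g} → FaceInvariant g → ∀ {x y} → SameFace x y → g x ≡ g y
  FaceInvariant-SameFace {g} inv {x} (k , refl) = go (toℕ k)
    where
    go : ∀ k → g x ≡ g (iter face k x)
    go zero    = refl
    go (suc k) = trans (go k) (sym (inv _))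

  -- On a vertex function `f ∘ tail` this is the coboundary up to sign. On a face function it
  -- compares the faces on the two sides of an edge, so it is the boundary of a 2-chain.
  ∇ : (Fin d → ℤ) → Fin d → ℤ
  ∇ h x = h x - h (rev x)

  ∇-antisym : ∀ h → Antisymmetric (∇ h)
  ∇-antisym h x = trans (cong (λ y → h (rev x) - h y) (rev-inv x)) (swap (h (rev x)) (h x))
    where
    swap : ∀ a b → a - b ≡ - (b - a)
    swap = solve-∀

  ∑-rev : ∀ (f : Fin d → ℤ) → ∑ (λ x → f (rev x)) ≡ ∑ f
  ∑-rev = ∑-reindex rev rev rev-inv rev-inv

  ∑-face : ∀ (f : Fin d → ℤ) → ∑ (λ x → f (face x)) ≡ ∑ f
  ∑-face = ∑-reindex face face⁻¹ face-face⁻¹ face⁻¹-face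

  -- Summation by parts: reindexing along `rev` turns the terms with `h (rev x)` into a second copy
  -- of the terms with `h x`.
  ∑-∇ : ∀ {ω} → Antisymmetric ω → ∀ h → ∑ (λ x → ω x * ∇ h x) ≡ ∑ (λ x → ω x * h x) + ∑ (λ x → ω x * h x)
  ∑-∇ {ω} anti h = begin
    ∑ (λ x → ω x * ∇ h x)                             ≡⟨ ∑-cong (λ x → pointwise x) ⟩
    ∑ (λ x → ω x * h x + ω (rev x) * h (rev x))       ≡⟨ ∑-+ _ _ ⟩
    ∑ (λ x → ω x * h x) + ∑ (λ x → ω (rev x) * h (rev x)) ≡⟨ cong (_+_ (∑ (λ x → ω x * h x))) (∑-rev (λ x → ω x * h x)) ⟩
    ∑ (λ x → ω x * h x) + ∑ (λ x → ω x * h x)         ∎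
    where
    expand : ∀ a b c → a * (b - c) ≡ a * b + - a * c
    expand = solve-∀
    pointwise : ∀ x → ω x * ∇ h x ≡ ω x * h x + ω (rev x) * h (rev x)
    pointwise x = trans (expand (ω x) (h x) (h (rev x))) (cong (λ a → ω x * h x + a * h (rev x)) (sym (anti x)))

  -- Orthogonality of coboundaries and boundaries. Since `rev x` and `face x` start at the same
  -- vertex, `f (rev x) * g x` equals the product of `f` and `g` at `face x`, and reindexing along
  -- `face` cancels it against the product at `x`.
  ∑-∇-∇ : ∀ {f g} → VertexInvariant f → FaceInvariant g → ∑ (λ x → ∇ f x * ∇ g x) ≡ 0ℤ
  ∑-∇-∇ {f} {g} f-inv g-inv = trans (∑-∇ (∇-antisym f) g) (cong₂ _+_ half half)
    where
    expand : ∀ a b c → (a - b) * c ≡ a * c - b * c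
    expand = solve-∀
    pointwise : ∀ x → ∇ f x * g x ≡ f x * g x - f (face x) * g (face x)
    pointwise x = trans (expand (f x) (f (rev x)) (g x))
      (cong₂ (λ a b → f x * g x - a * b) (sym (f-inv (rev x))) (sym (g-inv x)))
    half : ∑ (λ x → ∇ f x * g x) ≡ 0ℤ
    half = begin
      ∑ (λ x → ∇ f x * g x)                                     ≡⟨ ∑-cong pointwise ⟩
      ∑ (λ x → f x * g x - f (face x) * g (face x))             ≡⟨ ∑-- _ _ ⟩
      ∑ (λ x → f x * g x) - ∑ (λ x → f (face x) * g (face x))   ≡⟨ cong (_-_ (∑ (λ x → f x * g x))) (∑-face (λ x → f x * g x)) ⟩
      ∑ (λ x → f x * g x) - ∑ (λ x → f x * g x)                 ≡⟨ ℤ.i≡j⇒i-j≡0 (refl {x = ∑ (λ x → f x * g x)}) ⟩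
      0ℤ                                                        ∎

dot-- : ∀ {m} (a b x : Fin m → ℤ) → dot (λ i → a i - b i) x ≡ dot a x - dot b x
dot-- a b x = trans (∑-cong (λ i → expand (a i) (b i) (x i))) (∑-- _ _)
  where
  expand : ∀ a b c → (a - b) * c ≡ a * c - b * c
  expand = solve-∀

dot-+ : ∀ {m} (a b x : Fin m → ℤ) → dot (λ i → a i + b i) x ≡ dot a x + dot b x
dot-+ a b x = trans (∑-cong (λ i → ℤ.*-distribʳ-+ (x i) (a i) (b i))) (∑-+ _ _)

dot-* : ∀ {m} c (a x : Fin m → ℤ) → dot (λ i → c * a i) x ≡ c * dot a x
dot-* c a x = trans (∑-cong (λ i → ℤ.*-assoc c (a i) (x i))) (∑-* c _)

-- Discrete Hodge theory on the sphere

record Spherical {n} (M : Map n) : Set where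
  field
    euler : n ℕ.+ Map.numFaces M ≡ 2 ℕ.+ Map.numEdges M

-- A discrete Hodge decomposition: by Euler's formula the linear system ∇ (f ∘ tail) + ∇ g + c ω = 0, f v₀ = g x₀ = 0,
-- has more unknowns than equations, and the terms ∇ (f ∘ tail) and ∇ g are orthogonal.
module Hodge {n} (M : Map n) (spherical : Spherical M) where
  open Map M
  open Spherical spherical
  open MapProperties M

  module _ (ω : Fin d → ℤ) (anti : Antisymmetric ω) (v₀ : Fin n) (x₀ : Fin d) where

    private
      lower? : ∀ x → Dec (FaceRep x) → ∃ λ y → FaceRep x ⊎ (y Fin.< x × SameFace x y)
      lower? x (yes rep) = x , inj₁ rep
      lower? x (no ¬rep)
        with y , ¬imp ← Fin.¬∀⟶∃¬ d _ (λ y → (toℕ y ℕ.<? toℕ x) →-dec ¬? (SameFace? x y)) ¬rep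
        with toℕ y ℕ.<? toℕ x | SameFace? x y
      ... | yes y<x | yes same = y , inj₂ (y<x , same)
      ... | yes y<x | no ¬same = ⊥-elim (¬imp λ _ → ¬same)
      ... | no y≮x  | _        = ⊥-elim (¬imp λ y<x → ⊥-elim (y≮x y<x))

      lower : Fin d → Fin d
      lower x = proj₁ (lower? x (FaceRep? x))

      Up? : Decidable (λ x → x Fin.< rev x)
      Up? x = x Fin.<? rev x

      NonRep? : Decidable (λ x → ¬ FaceRep x)
      NonRep? = ¬? ∘ FaceRep?

      -- The unknowns are `c`, a value of `f` at each vertex and a value of `g` at each dart. Giving
      -- `g` one unknown per dart, tied together by the face rows, avoids a type of faces.
      N : ℕ
      N = suc (n ℕ.+ d)

      var-c : Fin N
      var-c = zero

      var-f : Fin n → Fin N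
      var-f v = suc (v ↑ˡ d)

      var-g : Fin d → Fin N
      var-g x = suc (n ↑ʳ x)

      edge-row face-row : Fin d → Fin N → ℤ
      edge-row x i = ((δ (var-f (tail x)) i - δ (var-f (head x)) i) + (δ (var-g x) i - δ (var-g (rev x)) i)) + ω x * δ var-c i
      face-row x i = δ (var-g x) i - δ (var-g (lower x)) i

      edge-rows face-rows rows : List (Fin N → ℤ)
      edge-rows = map edge-row (filter Up? (allFin d))
      face-rows = map face-row (filter NonRep? (allFin d))
      rows = δ (var-f v₀) ∷ δ (var-g x₀) ∷ (edge-rows ++ face-rows)

      up≤half : count Up? ℕ.≤ numEdges
      up≤half = ℕ.≤-trans (ℕ.≤-reflexive (sym (ℕ.m*n/n≡m (count Up?) 2))) (ℕ./-monoˡ-≤ 2 (ℕ.≤-trans (ℕ.≤-reflexive (ℕ.*-comm (count Up?) 2)) doubled))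
        where
        rev-up : ∀ i → ¬ (rev (count-lookup Up? i) Fin.< rev (rev (count-lookup Up? i)))
        rev-up i lt = ℕ.<-asym (count-lookup-holds Up? i)
          (subst (rev (count-lookup Up? i) Fin.<_) (rev-inv _) lt)
        up≤down : count Up? ℕ.≤ count (¬? ∘ Up?)
        up≤down = injection-count (¬? ∘ Up?) (λ i → rev (count-lookup Up? i)) rev-up
          (λ {i} {j} eq → count-lookup-injective Up? (trans (sym (rev-inv _)) (trans (cong rev eq) (rev-inv _))))
        doubled : 2 ℕ.* count Up? ℕ.≤ d
        doubled = ℕ.≤-trans (ℕ.+-monoʳ-≤ (count Up?) (ℕ.≤-trans (ℕ.≤-reflexive (ℕ.+-identityʳ _)) up≤down))
          (ℕ.≤-reflexive (count-¬ Up?))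

      -- There are two normalisations, at most E edge rows, and one face row for each of the d - F
      -- darts that do not represent their face. By Euler's formula 2 + E is n + F, so the rows
      -- number at most n + d, one fewer than the unknowns.
      rows<N : length rows ℕ.< N
      rows<N = s≤s (ℕ.≤-trans (ℕ.≤-reflexive (cong (2 ℕ.+_) (trans (length-++ edge-rows {face-rows}) (cong₂ ℕ._+_ (length-map edge-row (filter Up? (allFin d))) (length-map face-row (filter NonRep? (allFin d)))))))
        (ℕ.≤-trans (ℕ.+-monoˡ-≤ (count NonRep?) (s≤s (s≤s up≤half)))
        (ℕ.≤-reflexive (trans (cong (ℕ._+ count NonRep?) (sym euler))
          (trans (ℕ.+-assoc n _ _) (cong (n ℕ.+_) (count-¬ FaceRep?)))))))

    abstract
      hodge : ∃ λ (f : Fin n → ℤ) → ∃ λ (g : Fin d → ℤ) → ∃ λ (c : ℤ) →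
        FaceInvariant g × (∀ x → ∇ (f ∘ tail) x + ∇ g x + c * ω x ≡ 0ℤ) × f v₀ ≡ 0ℤ × g x₀ ≡ 0ℤ ×
        ¬ (c ≡ 0ℤ × (∀ v → f v ≡ 0ℤ) × (∀ x → g x ≡ 0ℤ))
      hodge with X , (j , Xⱼ≢0) , (f₀ ∷ g₀ ∷ solved) ← solution rows rows<N
        = f , g , c , face-invariant , balance , trans (sym (∑-δ (var-f v₀) X)) f₀ , trans (sym (∑-δ (var-g x₀) X)) g₀ , nonzero
        where
        f : Fin n → ℤ
        f = X ∘ var-f
        g : Fin d → ℤ
        g = X ∘ var-g
        c : ℤ
        c = X var-c

        nonzero : ¬ (c ≡ 0ℤ × (∀ v → f v ≡ 0ℤ) × (∀ x → g x ≡ 0ℤ))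
        nonzero (c≡0 , f≡0 , g≡0) = Xⱼ≢0 (all j)
          where
          all : ∀ i → X i ≡ 0ℤ
          all zero = c≡0
          all (suc i) with splitAt n i in eq
          ... | inj₁ v = trans (cong (X ∘ suc) (sym (Fin.splitAt⁻¹-↑ˡ eq))) (f≡0 v)
          ... | inj₂ x = trans (cong (X ∘ suc) (sym (Fin.splitAt⁻¹-↑ʳ eq))) (g≡0 x)

        edge-solved : ∀ x → x Fin.< rev x → dot (edge-row x) X ≡ 0ℤ
        edge-solved x up = All.lookup (All.++⁻ˡ edge-rows solved) (∈-map⁺ edge-row (∈-filter⁺ Up? (∈-allFin x) up))

        face-solved : ∀ x → ¬ FaceRep x → dot (face-row x) X ≡ 0ℤ
        face-solved x ¬rep = All.lookup (All.++⁻ʳ edge-rows solved) (∈-map⁺ face-row (∈-filter⁺ NonRep? (∈-allFin x) ¬rep))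

        edge-dot : ∀ x → dot (edge-row x) X ≡ ∇ (f ∘ tail) x + ∇ g x + c * ω x
        edge-dot x = begin
          dot (edge-row x) X
            ≡⟨ dot-+ (λ i → ef i + eg i) (λ i → ω x * δ var-c i) X ⟩
          dot (λ i → ef i + eg i) X + dot (λ i → ω x * δ var-c i) X
            ≡⟨ cong₂ _+_ (dot-+ ef eg X) (dot-* (ω x) (δ var-c) X) ⟩
          dot ef X + dot eg X + ω x * dot (δ var-c) X
            ≡⟨ cong₂ _+_ (cong₂ _+_ (δ-diff (var-f (tail x)) (var-f (head x))) (δ-diff (var-g x) (var-g (rev x))))
                         (trans (cong (ω x *_) (∑-δ var-c X)) (ℤ.*-comm (ω x) c)) ⟩
          ∇ (f ∘ tail) x + ∇ g x + c * ω x ∎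
          where
          ef eg : Fin N → ℤ
          ef i = δ (var-f (tail x)) i - δ (var-f (head x)) i
          eg i = δ (var-g x) i - δ (var-g (rev x)) i
          δ-diff : ∀ i j → dot (λ k → δ i k - δ j k) X ≡ X i - X j
          δ-diff i j = trans (dot-- (δ i) (δ j) X) (cong₂ _-_ (∑-δ i X) (∑-δ j X))

        balance : ∀ x → ∇ (f ∘ tail) x + ∇ g x + c * ω x ≡ 0ℤ
        balance x with ℕ.<-cmp (toℕ x) (toℕ (rev x))
        ... | tri< x<rev _ _ = trans (sym (edge-dot x)) (edge-solved x x<rev)
        ... | tri≈ _ x≡rev _ = ⊥-elim (rev-fp x (sym (Fin.toℕ-injective x≡rev)))
        -- The row of this edge belongs to `rev x`; all three terms are antisymmetric, so the
        -- equation carries over with a sign.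
        ... | tri> _ _ rev<x = begin
          ∇ (f ∘ tail) x + ∇ g x + c * ω x
            ≡⟨ negate (∇ (f ∘ tail) x) (∇ g x) c (ω x) ⟩
          - (- ∇ (f ∘ tail) x + - ∇ g x + c * - ω x)
            ≡⟨ cong -_ (cong₂ _+_ (cong₂ _+_ (∇-antisym (f ∘ tail) x) (∇-antisym g x)) (cong (c *_) (anti x))) ⟨
          - (∇ (f ∘ tail) (rev x) + ∇ g (rev x) + c * ω (rev x))
            ≡⟨ cong -_ (trans (sym (edge-dot (rev x))) (edge-solved (rev x) (subst (rev x Fin.<_) (sym (rev-inv x)) rev<x))) ⟩
          0ℤ ∎
          where
          negate : ∀ p q r s → p + q + r * s ≡ - (- p + - q + r * - s)
          negate = solve-∀

        g-lower : ∀ x → ¬ FaceRep x → g x ≡ g (lower x)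
        g-lower x ¬rep = ℤ.i-j≡0⇒i≡j (g x) (g (lower x)) (begin
          g x - g (lower x)     ≡⟨ cong₂ _-_ (∑-δ (var-g x) X) (∑-δ (var-g (lower x)) X) ⟨
          dot (δ (var-g x)) X - dot (δ (var-g (lower x))) X ≡⟨ dot-- (δ (var-g x)) (δ (var-g (lower x))) X ⟨
          dot (face-row x) X    ≡⟨ face-solved x ¬rep ⟩
          0ℤ                    ∎)

        -- The face rows equate `g x` with `g (lower x)`, and `lower` strictly decreases the index
        -- until the least dart of the face is reached. Face invariance follows because `x` and
        -- `face x` descend to the same least dart.
        to-rep : ∀ k x → toℕ x ℕ.< k → ∃ λ r → FaceRep r × SameFace x r × g x ≡ g r
        to-rep (suc k) x (s≤s x≤k) with lower? x (FaceRep? x) in eq | FaceRep? x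
        ... | y , inj₁ rep            | _       = x , rep , sameFace 0 refl , refl
        ... | y , inj₂ _              | yes rep = x , rep , sameFace 0 refl , refl
        ... | y , inj₂ (y<x , same)   | no ¬rep
          with r , rep , y~r , gy≡gr ← to-rep k y (ℕ.<-≤-trans y<x x≤k)
          = r , rep , SameFace-trans same y~r , trans (g-lower x ¬rep) (trans (cong (g ∘ proj₁) eq) gy≡gr)

        rep-unique : ∀ {r s} → FaceRep r → FaceRep s → SameFace r s → r ≡ s
        rep-unique {r} {s} rep-r rep-s same with ℕ.<-cmp (toℕ r) (toℕ s)
        ... | tri< r<s _ _ = ⊥-elim (rep-s r r<s (SameFace-sym same))
        ... | tri≈ _ r≡s _ = Fin.toℕ-injective r≡s
        ... | tri> _ _ s<r = ⊥-elim (rep-r s s<r same)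

        face-invariant : FaceInvariant g
        face-invariant x
          with r , rep-r , x~r , gx≡gr ← to-rep d x (Fin.toℕ<n x)
          with s , rep-s , y~s , gy≡gs ← to-rep d (face x) (Fin.toℕ<n (face x))
          = trans gy≡gs (trans (cong g (rep-unique rep-s rep-r (SameFace-trans (SameFace-sym y~s) (SameFace-trans (SameFace-sym (SameFace-face x)) x~r)))) (sym gx≡gr))

  module _ (connected : ∀ u v → Conn Adj (λ _ → ⊤) u v) (v₀ : Fin n) (x₀ : Fin d) where

    -- Dual formulations: testing against indicators of faces gives vanishing sums around faces, and
    -- testing against indicators of vertices gives vanishing net flow at vertices.
    Closed Cycle : (Fin d → ℤ) → Set
    Closed ω = ∀ g → FaceInvariant g → ∑ (λ x → ω x * g x) ≡ 0ℤ
    Cycle ω  = ∀ (f : Fin n → ℤ) → ∑ (λ x → ω x * f (tail x)) ≡ 0ℤ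

    private
      ∇≡0⇒≡ : ∀ h x → ∇ h x ≡ 0ℤ → h x ≡ h (rev x)
      ∇≡0⇒≡ h x = ℤ.i-j≡0⇒i≡j (h x) (h (rev x))

      vertex-constant : ∀ {h} → VertexInvariant h → ∀ x y → tail x ≡ tail y → h x ≡ h y
      vertex-constant {h} inv x y eq with k , refl ← rot-trans x y eq = go k
        where
        go : ∀ k → h x ≡ h (iter rot k x)
        go zero    = refl
        go (suc k) = trans (go k) (sym (inv _))

      constant : ∀ {h} → VertexInvariant h → (∀ x → h x ≡ h (rev x)) → ∀ {u v} → Conn Adj (λ _ → ⊤) u v →
        ∀ x y → tail x ≡ u → tail y ≡ v → h x ≡ h y
      constant inv sym-h (end _) x y tx ty = vertex-constant inv x y (trans tx (sym ty))
      constant inv sym-h (hop _ (z , tz , hz) p) x y tx ty =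
        trans (vertex-constant inv x z (trans tx (sym tz))) (trans (sym-h z) (constant inv sym-h p (rev z) y hz ty))

      -- Since `face (rev x)` is `rot x`, a face function with equal values at `x` and `rev x` is
      -- also invariant under `rot`, hence constant on a connected map.
      g-zero : ∀ {g} → FaceInvariant g → g x₀ ≡ 0ℤ → (∀ x → ∇ g x ≡ 0ℤ) → ∀ x → g x ≡ 0ℤ
      g-zero {g} inv g₀ flat x = trans (constant {g} rot-inv sym-g (connected (tail x) (tail x₀)) x x₀ refl refl) g₀
        where
        sym-g : ∀ x → g x ≡ g (rev x)
        sym-g x = ∇≡0⇒≡ g x (flat x)
        rot-inv : VertexInvariant g
        rot-inv x = trans (cong g (sym (face-rev x))) (trans (inv (rev x)) (sym (sym-g x)))

      f-zero : ∀ {f : Fin n → ℤ} → f v₀ ≡ 0ℤ → (∀ x → ∇ (f ∘ tail) x ≡ 0ℤ) → ∀ v → f v ≡ 0ℤ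
      f-zero {f} f₀ flat v = trans (go (connected v v₀)) f₀
        where
        go : ∀ {u w} → Conn Adj (λ _ → ⊤) u w → f u ≡ f w
        go (end _) = refl
        go (hop _ (z , refl , refl) p) = trans (∇≡0⇒≡ (f ∘ tail) z (flat z)) (go p)

      -- Pairing the relation with `β` removes the other two terms and leaves the sum of the squares
      -- of `β`.
      orthogonal⇒zero : ∀ {α β ω : Fin d → ℤ} {c} → (∀ x → α x + β x + c * ω x ≡ 0ℤ) →
        ∑ (λ x → α x * β x) ≡ 0ℤ → ∑ (λ x → ω x * β x) ≡ 0ℤ → ∀ x → β x ≡ 0ℤ
      orthogonal⇒zero {α} {β} {ω} {c} bal αβ ωβ = ∑-squares≡0 β (begin
        ∑ (λ x → β x * β x)
          ≡⟨ ∑-cong (λ x → trans (expand (α x) (β x) c (ω x)) (cong (λ e → e * β x - (α x * β x + c * (ω x * β x))) (bal x))) ⟩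
        ∑ (λ x → 0ℤ * β x - (α x * β x + c * (ω x * β x)))
          ≡⟨ ∑-- _ _ ⟩
        ∑ (λ x → 0ℤ * β x) - ∑ (λ x → α x * β x + c * (ω x * β x))
          ≡⟨ cong₂ _-_ (∑-zero (λ _ → refl)) (trans (∑-+ _ _) (cong₂ _+_ αβ (trans (∑-* c _) (trans (cong (c *_) ωβ) (ℤ.*-zeroʳ c))))) ⟩
        0ℤ ∎)
        where
        expand : ∀ a b c w → b * b ≡ (a + b + c * w) * b - (a * b + c * (w * b))
        expand = solve-∀

      ∑-∇-zero : ∀ {ω} → Antisymmetric ω → ∀ {h} → ∑ (λ x → ω x * h x) ≡ 0ℤ → ∑ (λ x → ω x * ∇ h x) ≡ 0ℤ
      ∑-∇-zero anti {h} eq = trans (∑-∇ anti h) (cong₂ _+_ eq eq)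

    abstract
      -- In the relation from `hodge`, both `∇ (f ∘ tail)` and `ω` are orthogonal to `∇ g`, so `∇ g`
      -- vanishes. If `c` were zero, then `f` and `g` would be constant, and zero by their
      -- normalisation, contrary to the nontriviality of the solution.
      closed⇒exact : ∀ {ω} → Antisymmetric ω → Closed ω →
        ∃ λ c → ∃ λ (f : Fin n → ℤ) → c ≢ 0ℤ × (∀ x → c * ω x ≡ f (head x) - f (tail x))
      closed⇒exact {ω} anti closed
        with f , g , c , g-inv , balance , f₀ , g₀ , nonzero ← hodge ω anti v₀ x₀
        = c , f , c≢0 , λ x → trans (solve-c (∇ (f ∘ tail) x) (∇ g x) (c * ω x) (balance x))
            (trans (cong (λ e → - (∇ (f ∘ tail) x + e)) (∇g≡0 x)) (tidy (f (tail x)) (f (head x))))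
        where
        ∇g≡0 : ∀ x → ∇ g x ≡ 0ℤ
        ∇g≡0 = orthogonal⇒zero {α = ∇ (f ∘ tail)} {ω = ω} {c} balance
          (∑-∇-∇ {f ∘ tail} (λ x → cong f (rot-tail x)) g-inv) (∑-∇-zero anti (closed g g-inv))
        solve-c : ∀ a b e → a + b + e ≡ 0ℤ → e ≡ - (a + b)
        solve-c a b e eq = trans (cancel a b e) (trans (cong (_- (a + b)) eq) (ℤ.+-identityˡ _))
          where
          cancel : ∀ a b e → e ≡ a + b + e - (a + b)
          cancel = solve-∀
        tidy : ∀ a b → - (a - b + 0ℤ) ≡ b - a
        tidy = solve-∀
        c≢0 : c ≢ 0ℤ
        c≢0 refl = nonzero (refl , f-zero f₀ flat , g-zero g-inv g₀ ∇g≡0)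
          where
          flat : ∀ x → ∇ (f ∘ tail) x ≡ 0ℤ
          flat x = trans (drop (∇ (f ∘ tail) x) (ω x)) (trans (cong (λ e → ∇ (f ∘ tail) x + e + 0ℤ * ω x) (sym (∇g≡0 x))) (balance x))
            where
            drop : ∀ a w → a ≡ a + 0ℤ + 0ℤ * w
            drop = solve-∀

    abstract
      -- The dual argument, with `∇ (f ∘ tail)` vanishing. Multiplying the relation by `c` makes the
      -- coefficient `c * c` positive, which matters when values of the face function are compared
      -- with a threshold.
      cycle⇒boundary : ∀ {ω} → Antisymmetric ω → Cycle ω →
        ∃ λ c → ∃ λ g → 0ℤ ℤ.< c × FaceInvariant g × (∀ x → c * ω x ≡ ∇ g x)
      cycle⇒boundary {ω} anti cycle
        with f , g , c , g-inv , balance , f₀ , g₀ , nonzero ← hodge ω anti v₀ x₀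
        = c * c , (λ x → - c * g x) , positive c c≢0 , (λ x → cong (- c *_) (g-inv x)) , λ x → begin
            c * c * ω x                                   ≡⟨ rearrange c (ω x) (∇ (f ∘ tail) x) (g x) (g (rev x)) ⟩
            c * (∇ (f ∘ tail) x + ∇ g x + c * ω x) - c * ∇ (f ∘ tail) x + (- c * g x - - c * g (rev x))
              ≡⟨ cong₂ (λ a b → c * a - c * b + (- c * g x - - c * g (rev x))) (balance x) (∇f≡0 x) ⟩
            c * 0ℤ - c * 0ℤ + (- c * g x - - c * g (rev x)) ≡⟨ tidy c (- c * g x - - c * g (rev x)) ⟩
            (- c * g x - - c * g (rev x))                 ∎
        where
        rearrange : ∀ c w a p q → c * c * w ≡ c * (a + (p - q) + c * w) - c * a + (- c * p - - c * q)
        rearrange = solve-∀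
        tidy : ∀ c e → c * 0ℤ - c * 0ℤ + e ≡ e
        tidy = solve-∀
        positive : ∀ c → c ≢ 0ℤ → 0ℤ ℤ.< c * c
        positive (+ zero)  c≢0 = ⊥-elim (c≢0 refl)
        positive (+ suc n) c≢0 = ℤ.+<+ (s≤s z≤n)
        positive -[1+ n ]  c≢0 = ℤ.+<+ (s≤s z≤n)
        ∇f≡0 : ∀ x → ∇ (f ∘ tail) x ≡ 0ℤ
        ∇f≡0 = orthogonal⇒zero {α = ∇ g} {ω = ω} {c} (λ x → trans (cong (_+ c * ω x) (ℤ.+-comm (∇ g x) _)) (balance x))
          (trans (∑-cong (λ x → ℤ.*-comm (∇ g x) _)) (∑-∇-∇ {f ∘ tail} (λ x → cong f (rot-tail x)) g-inv)) (∑-∇-zero anti (cycle f))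
        c≢0 : c ≢ 0ℤ
        c≢0 refl = nonzero (refl , f-zero f₀ ∇f≡0 , g-zero g-inv g₀ flat)
          where
          flat : ∀ x → ∇ g x ≡ 0ℤ
          flat x = trans (drop (∇ g x) (ω x)) (trans (cong (λ e → e + ∇ g x + 0ℤ * ω x) (sym (∇f≡0 x))) (balance x))
            where
            drop : ∀ a w → a ≡ 0ℤ + a + 0ℤ * w
            drop = solve-∀

-- Menger's theorem

¬¬-em : ∀ {A : Set} → ¬ ¬ (A ⊎ ¬ A)
¬¬-em k = k (inj₂ (k ∘ inj₁))

-- A walk ends at its first vertex in `Y`, so the target is its only vertex there; other vertices
-- may repeat.
data Walk {V : Set} (R : V → V → Set) (Y : V → Set) : V → Set where
  stop : ∀ {u} → Y u → Walk R Y u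
  step : ∀ {u w} → ¬ Y u → R u w → Walk R Y w → Walk R Y u

module _ {V : Set} {R : V → V → Set} {Y : V → Set} where

  target : ∀ {u} → Walk R Y u → V
  target {u} (stop _)     = u
  target     (step _ _ p) = target p

  On : ∀ {u} → Walk R Y u → V → Set
  On {u} (stop _)     w = w ≡ u
  On {u} (step _ _ p) w = w ≡ u ⊎ On p w

  target-holds : ∀ {u} (p : Walk R Y u) → Y (target p)
  target-holds (stop y)     = y
  target-holds (step _ _ p) = target-holds p

  target-on : ∀ {u} (p : Walk R Y u) → On p (target p)
  target-on (stop _)     = refl
  target-on (step _ _ p) = inj₂ (target-on p)

  on-target : ∀ {u w} (p : Walk R Y u) → On p w → Y w → w ≡ target p
  on-target (stop _)      refl        y = refl
  on-target (step ¬y _ p) (inj₁ refl) y = contradiction y ¬y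
  on-target (step _ _ p)  (inj₂ on)   y = on-target p on y

  walk⇒conn : ∀ {u} (p : Walk R Y u) → Conn R (On p) u (target p)
  walk⇒conn (stop _)     = end refl
  walk⇒conn (step _ r p) = hop (inj₁ refl) r (Conn-map id inj₂ (walk⇒conn p))

  prefix : ∀ {u w} (p : Walk R Y u) → On p w → w ≡ target p ⊎ Conn R (λ v → ¬ Y v) u w
  prefix (stop _)      refl        = inj₁ refl
  prefix (step ¬y _ p) (inj₁ refl) = inj₂ (end ¬y)
  prefix (step ¬y r p) (inj₂ on) with prefix p on
  ... | inj₁ eq = inj₁ eq
  ... | inj₂ q  = inj₂ (hop ¬y r q)

  truncate : Decidable Y → ∀ {Q u v} → Conn R Q u v → Y v → Σ (Walk R Y u) λ p → ∀ {w} → On p w → Q w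
  truncate Y? (end q) y = stop y , λ where refl → q
  truncate Y? {u = u} (hop q r c) y with Y? u
  ... | yes yu = stop yu , λ where refl → q
  ... | no ¬yu with p , sub ← truncate Y? c y = step ¬yu r p , λ where
    (inj₁ refl) → q
    (inj₂ on)   → sub on

walk-map : ∀ {V : Set} {R R′ : V → V → Set} {Y : V → Set} → (∀ {u w} → R u w → R′ u w) →
  ∀ {u} (p : Walk R Y u) → Σ (Walk R′ Y u) λ p′ → ∀ {w} → On p′ w → On p w
walk-map f (stop y) = stop y , id
walk-map f (step ¬y r p) with p′ , sub ← walk-map f p = step ¬y (f r) p′ , λ where
  (inj₁ eq) → inj₁ eq
  (inj₂ on) → inj₂ (sub on)

record Linkage {V : Set} (R : V → V → Set) (k : ℕ) (X Y : V → Set) : Set where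
  field
    source   : Fin k → V
    source-X : ∀ i → X (source i)
    walk     : ∀ i → Walk R Y (source i)
    disjoint : ∀ {i j v} → On (walk i) v → On (walk j) v → i ≡ j

module Menger {n : ℕ} where

  private
    V = Fin n

    _∈?_ : ∀ (v : V) S → Dec (v ∈ S)
    v ∈? S = any? (v Fin.≟_) S

  Side : (V → V → Set) → List V → (V → Set) → V → Set
  Side R S X z = ∃ λ u → X u × Conn R (_∉ S) u z

  Joined : (V → V → Set) → List V → (X Y : V → Set) → Set
  Joined R S X Y = ∃ λ v → Y v × Side R S X v

  module _ {R : V → V → Set} (R-sym : ∀ {u w} → R u w → R w u) where

    sides⇒joined : ∀ {S X Y z} → Side R S X z → Side R S Y z → Joined R S X Y
    sides⇒joined (u , Xu , p) (v , Yv , q) = v , Yv , u , Xu , p ++ᶜ Conn-sym R-sym q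

    joined-sym : ∀ {S X Y} → Joined R S X Y → Joined R S Y X
    joined-sym (v , Yv , u , Xu , p) = u , Xu , v , Yv , Conn-sym R-sym p

  module AddEdge {R R′ : V → V → Set} (R-sym : ∀ {u w} → R u w → R w u) (R′-sym : ∀ {u w} → R′ u w → R′ w u)
    (R′⇒R : ∀ {u w} → R′ u w → R u w) {k : ℕ} where

    New : V → V → Set
    New x y = ∀ {u w} → R u w → R′ u w ⊎ (u ≡ x × w ≡ y) ⊎ (u ≡ y × w ≡ x)

    New-sym : ∀ {x y} → New x y → New y x
    New-sym new r with new r
    ... | inj₁ r′        = inj₁ r′
    ... | inj₂ (inj₁ eq) = inj₂ (inj₂ eq)
    ... | inj₂ (inj₂ eq) = inj₂ (inj₁ eq)

    -- Seen from `Y`, the part of the walk before its first use of the new edge lies in `R′` and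
    -- leads to an end of that edge.
    touch : ∀ {x y} → New x y → ∀ {S Y w} → Side R S Y w → Side R′ S Y w ⊎ Side R′ S Y x ⊎ Side R′ S Y y
    touch {x} {y} new {S} {Y} (v , Yv , p) = go (Conn-sym R-sym p)
      where
      go : ∀ {w} → Conn R (_∉ S) w v → Side R′ S Y w ⊎ Side R′ S Y x ⊎ Side R′ S Y y
      go (end q) = inj₁ (v , Yv , end q)
      go (hop q r p) with go p
      ... | inj₂ s = inj₂ s
      ... | inj₁ s@(_ , Yv′ , p′) with new r
      ...   | inj₁ r′                 = inj₁ (_ , Yv′ , p′ ++ᶜ hop (Conn-target p′) (R′-sym r′) (end q))
      ...   | inj₂ (inj₁ (_ , refl))  = inj₂ (inj₂ s)
      ...   | inj₂ (inj₂ (_ , refl))  = inj₂ (inj₁ s)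

    -- The walk from `X` is followed to its first vertex in `x ∷ S`. Until then it cannot use the
    -- new edge: it has not reached `x`, and reaching `y` would join `X` to `Y` in `R′` outside `S`.
    -- It must meet `x ∷ S`, since otherwise it would itself be such a connection. So a set
    -- separating `X` from `x ∷ S` in `R′` also separates `X` from `Y` in `R`.
    half : ∀ {x y} → New x y → ∀ {S X Y} → ¬ Joined R′ S X Y → Side R′ S Y y →
      ∀ T → Joined R T X Y → Joined R′ T X (_∈ x ∷ S)
    half {x} {y} new {S} {X} {Y} separated Yy T (v , Yv , u , Xu , p) with u ∈? (x ∷ S)
    ... | yes u∈ = u , u∈ , u , Xu , end (Conn-source p)
    ... | no u∉ = go p u∉ (end (Conn-source p)) (end (u∉ ∘ there))
      where
      go : ∀ {w} → Conn R (_∉ T) w v → w ∉ x ∷ S → Conn R′ (_∉ T) u w → Conn R′ (_∉ S) u w → Joined R′ T X (_∈ x ∷ S)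
      go (end _) w∉ pT pS = contradiction (v , Yv , u , Xu , pS) separated
      go (hop {w = w′} q r p) w∉ pT pS with new r
      ... | inj₂ (inj₁ (refl , _)) = contradiction (here refl) w∉
      ... | inj₂ (inj₂ (refl , _)) = contradiction (sides⇒joined R′-sym (u , Xu , pS) Yy) separated
      ... | inj₁ r′ with w′ ∈? (x ∷ S)
      ...   | yes w′∈ = w′ , w′∈ , u , Xu , pT ++ᶜ hop q r′ (end (Conn-source p))
      ...   | no w′∉ = go p w′∉ (pT ++ᶜ hop q r′ (end (Conn-source p))) (pS ++ᶜ hop (w∉ ∘ there) r′ (end (w′∉ ∘ there)))

    -- Because the two sides of `S` are disjoint, walks coming from different sides can then only
    -- meet at a common end in `S`.
    on-side : ∀ {x S X} → Side R′ S X x → ∀ {u w} → X u → (p : Walk R′ (_∈ x ∷ S) u) → On p w →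
      (w ∈ S × w ≡ target p) ⊎ Side R′ S X w
    on-side Xx Xu p on with prefix p on
    ... | inj₂ q = inj₂ (_ , Xu , Conn-map id (λ w∉ → w∉ ∘ there) q)
    ... | inj₁ refl with target-holds p
    ...   | here eq   = inj₂ (subst (Side R′ _ _) (sym eq) Xx)
    ...   | there w∈S = inj₁ (w∈S , refl)

    -- The k walks of α end in distinct vertices of x ∷ S, hence reach all of them, and similarly for β;
    -- walks of α and β with a common end in S are glued, and the ones ending in x and y are joined by the new edge.
    combine : ∀ {x y} → R x y → ∀ {S X Y} → Decidable Y → length S ℕ.< k → ¬ Joined R′ S X Y → Side R′ S X x → Side R′ S Y y →
      Linkage R′ k X (_∈ x ∷ S) → Linkage R′ k Y (_∈ y ∷ S) → Linkage R k X Y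
    combine {x} {y} Rxy {S} {X} {Y} Y? |S|<k separated Xx Yy α β = record
      { source   = λ j → α.source (mate j)
      ; source-X = λ j → α.source-X (mate j)
      ; walk     = λ j → proj₁ (joined j)
      ; disjoint = λ {j} {j′} on on′ → apart (proj₂ (joined j) on) (proj₂ (joined j′) on′)
      }
      where
      module α = Linkage α
      module β = Linkage β

      x∉S : x ∉ S
      x∉S = Conn-target (proj₂ (proj₂ Xx))

      hit : ∀ {z} → z ∈ x ∷ S → ∃ λ i → target (α.walk i) ≡ z
      hit {z} z∈ with Fin.any? (λ i → target (α.walk i) Fin.≟ z)
      ... | yes found = found
      ... | no ¬found = contradiction (injection-length (x ∷ S) ends ends∈ ends-injective) (ℕ.<⇒≱ (s≤s |S|<k))
        where
        ends : Fin (suc k) → V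
        ends zero    = z
        ends (suc i) = target (α.walk i)
        ends∈ : ∀ i → ends i ∈ x ∷ S
        ends∈ zero    = z∈
        ends∈ (suc i) = target-holds (α.walk i)
        ends-injective : ∀ {i j} → ends i ≡ ends j → i ≡ j
        ends-injective {zero}  {zero}  eq = refl
        ends-injective {zero}  {suc j} eq = contradiction (j , sym eq) ¬found
        ends-injective {suc i} {zero}  eq = contradiction (i , eq) ¬found
        ends-injective {suc i} {suc j} eq = cong suc (α.disjoint (target-on (α.walk i)) (subst (On (α.walk j)) (sym eq) (target-on (α.walk j))))

      Link : Fin k → Fin k → Set
      Link i j = (target (α.walk i) ≡ target (β.walk j) × target (α.walk i) ∈ S) ⊎ (target (α.walk i) ≡ x × target (β.walk j) ≡ y)

      linked : ∀ j → ∃ λ i → Link i j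
      linked j with target-holds (β.walk j)
      ... | here eq with i , eq′ ← hit (here refl) = i , inj₂ (eq′ , eq)
      ... | there t∈S with i , eq′ ← hit (there t∈S) = i , inj₁ (eq′ , subst (_∈ S) (sym eq′) t∈S)

      mate : Fin k → Fin k
      mate j = proj₁ (linked j)

      Support : Fin k → V → Set
      Support j w = On (α.walk (mate j)) w ⊎ On (β.walk j) w

      there-half : ∀ j → Conn R (Support j) (α.source (mate j)) (target (α.walk (mate j)))
      there-half j = Conn-map R′⇒R inj₁ (walk⇒conn (α.walk (mate j)))

      back-half : ∀ j → Conn R (Support j) (target (β.walk j)) (β.source j)
      back-half j = Conn-sym R-sym (Conn-map R′⇒R inj₂ (walk⇒conn (β.walk j)))

      joined : ∀ j → Σ (Walk R Y (α.source (mate j))) λ p → ∀ {w} → On p w → Support j w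
      joined j = truncate Y? (glue (proj₂ (linked j))) (β.source-X j)
        where
        glue : Link (mate j) j → Conn R (Support j) (α.source (mate j)) (β.source j)
        glue (inj₁ (eq , _)) = there-half j ++ᶜ subst (λ t → Conn R (Support j) t (β.source j)) (sym eq) (back-half j)
        glue (inj₂ (eqx , eqy)) = there-half j ++ᶜ
          hop (inj₁ (target-on (α.walk (mate j)))) (subst₂ R (sym eqx) (sym eqy) Rxy) (back-half j)

      β-target-injective : ∀ {j j′} → target (β.walk j) ≡ target (β.walk j′) → j ≡ j′
      β-target-injective {j} {j′} eq = β.disjoint (target-on (β.walk j)) (subst (On (β.walk j′)) (sym eq) (target-on (β.walk j′)))

      link-injective : ∀ {i j j′} → Link i j → Link i j′ → j ≡ j′
      link-injective (inj₁ (eq , _)) (inj₁ (eq′ , _)) = β-target-injective (trans (sym eq) eq′)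
      link-injective (inj₂ (_ , eq)) (inj₂ (_ , eq′)) = β-target-injective (trans eq (sym eq′))
      link-injective (inj₁ (_ , t∈S)) (inj₂ (eq , _)) = contradiction (subst (_∈ S) eq t∈S) x∉S
      link-injective (inj₂ (eq , _)) (inj₁ (_ , t∈S)) = contradiction (subst (_∈ S) eq t∈S) x∉S

      crossing : ∀ {i j j′ w} → Link i j → On (α.walk i) w → On (β.walk j′) w → j ≡ j′
      crossing {i} {j} {j′} link on on′
        with on-side Xx (α.source-X i) (α.walk i) on | on-side Yy (β.source-X j′) (β.walk j′) on′
      ... | inj₂ s | inj₂ s′ = contradiction (sides⇒joined R′-sym s s′) separated
      ... | inj₁ (w∈S , _) | inj₂ (_ , _ , p) = contradiction w∈S (Conn-target p)
      ... | inj₂ (_ , _ , p) | inj₁ (w∈S , _) = contradiction w∈S (Conn-target p)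
      ... | inj₁ (w∈S , eq) | inj₁ (_ , eq′) =
        link-injective link (inj₁ (trans (sym eq) eq′ , subst (_∈ S) eq w∈S))

      apart : ∀ {j j′ w} → Support j w → Support j′ w → j ≡ j′
      apart {j} {j′} (inj₁ a) (inj₁ a′) =
        link-injective (proj₂ (linked j)) (subst (λ i → Link i j′) (sym (α.disjoint a a′)) (proj₂ (linked j′)))
      apart (inj₂ b) (inj₂ b′) = β.disjoint b b′
      apart {j} (inj₁ a) (inj₂ b′) = crossing (proj₂ (linked j)) a b′
      apart {j′ = j′} (inj₂ b) (inj₁ a′) = sym (crossing (proj₂ (linked j′)) a′ b)

  Edge : List (V × V) → V → V → Set
  Edge E u w = (u , w) ∈ E ⊎ (w , u) ∈ E

  Edge-sym : ∀ E {u w} → Edge E u w → Edge E w u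
  Edge-sym E (inj₁ e) = inj₂ e
  Edge-sym E (inj₂ e) = inj₁ e

  -- Göring's induction on the edges. Double negation avoids deciding whether a small separator exists.
  menger : ∀ E k {X Y : V → Set} → Decidable Y → (∀ S → length S ℕ.< k → ¬ ¬ Joined (Edge E) S X Y) →
    ¬ ¬ Linkage (Edge E) k X Y
  menger [] k {X} {Y} Y? joins ¬link = choose k ℕ.≤-refl λ where
      (s , s-inj , sX , sY) → ¬link (record
        { source = s ; source-X = sX ; walk = λ i → stop (sY i)
        ; disjoint = λ eq eq′ → s-inj (trans (sym eq) eq′) })
    where
    -- Without edges a connection is a single vertex of both `X` and `Y`. Taking the vertices chosen
    -- so far as the separator yields a new one each time.
    choose : ∀ j → j ℕ.≤ k → ¬ ¬ (∃ λ (s : Fin j → V) → (∀ {i i′} → s i ≡ s i′ → i ≡ i′) × (∀ i → X (s i)) × (∀ i → Y (s i)))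
    choose zero    _   ¬s = ¬s ((λ ()) , (λ {i} → ⊥-elim (Fin.¬Fin0 i)) , (λ ()) , (λ ()))
    choose (suc j) j<k ¬s = choose j (ℕ.<⇒≤ j<k) λ where
      (s , s-inj , sX , sY) → joins (tabulate s) (ℕ.≤-<-trans (ℕ.≤-reflexive (length-tabulate s)) j<k) λ where
        (_ , _ , _ , _ , hop _ (inj₁ ()) _)
        (_ , _ , _ , _ , hop _ (inj₂ ()) _)
        (v , Yv , _ , Xv , end v∉s) → ¬s
          ( (λ { zero → v ; (suc i) → s i })
          , (λ { {zero} {zero} _ → refl
               ; {zero} {suc i} eq → contradiction (subst (_∈ tabulate s) (sym eq) (∈-tabulate⁺ {f = s} i)) v∉s
               ; {suc i} {zero} eq → contradiction (subst (_∈ tabulate s) eq (∈-tabulate⁺ {f = s} i)) v∉s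
               ; {suc i} {suc i′} eq → cong suc (s-inj eq) })
          , (λ { zero → Xv ; (suc i) → sX i })
          , (λ { zero → Yv ; (suc i) → sY i }))
  menger ((x , y) ∷ E) k {X} {Y} Y? joins ¬link = ¬¬-em λ where
      (inj₂ none) → menger E k Y? (λ S lt ¬joined → none (S , lt , ¬joined)) λ α → ¬link (weaken α)
      -- Here `S` separates without the new edge but not with it, so the ends of that edge lie on
      -- opposite sides of `S`.
      (inj₁ (S , lt , separated)) → joins S lt (split S lt separated)
    where
    R = Edge ((x , y) ∷ E)
    R′ = Edge E
    open AddEdge {R} {R′} (Edge-sym ((x , y) ∷ E)) (Edge-sym E) [ inj₁ ∘ there , inj₂ ∘ there ]′ {k}

    new : New x y
    new (inj₁ (here refl)) = inj₂ (inj₁ (refl , refl))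
    new (inj₁ (there e))   = inj₁ (inj₁ e)
    new (inj₂ (here refl)) = inj₂ (inj₂ (refl , refl))
    new (inj₂ (there e))   = inj₁ (inj₂ e)

    weaken : Linkage R′ k X Y → Linkage R k X Y
    weaken α = record
      { source = source ; source-X = source-X
      ; walk = λ i → proj₁ (lifted i)
      ; disjoint = λ {i} {j} on on′ → disjoint (proj₂ (lifted i) on) (proj₂ (lifted j) on′) }
      where
      open Linkage α
      lifted : ∀ i → Σ (Walk R Y (source i)) λ p → ∀ {w} → On p w → On (walk i) w
      lifted i = walk-map [ inj₁ ∘ there , inj₂ ∘ there ]′ (walk i)

    oriented : ∀ {a b} → New a b → R a b → ∀ S → length S ℕ.< k → ¬ Joined R′ S X Y → Side R′ S X a → Side R′ S Y b → ⊥
    oriented {a} {b} new-ab Rab S lt separated Xa Yb =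
      menger E k (_∈? (a ∷ S)) (λ T lt′ ¬j → joins T lt′ (¬j ∘ half new-ab separated Yb T)) λ α →
      menger E k (_∈? (b ∷ S)) (λ T lt′ ¬j → joins T lt′ (¬j ∘ half (New-sym new-ab) (separated ∘ joined-sym (Edge-sym E)) Xa T ∘ joined-sym (Edge-sym ((x , y) ∷ E)))) λ β →
      ¬link (combine Rab Y? lt separated Xa Yb α β)

    split : ∀ S → length S ℕ.< k → ¬ Joined R′ S X Y → ¬ Joined R S X Y
    split S lt separated (v , Yv , u , Xu , p)
      with touch new (u , Xu , p) | touch new (v , Yv , Conn-sym (Edge-sym ((x , y) ∷ E)) p)
    ... | inj₁ s | _ = separated (v , Yv , s)
    ... | _ | inj₁ s = separated (joined-sym (Edge-sym E) (u , Xu , s))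
    ... | inj₂ (inj₁ sx) | inj₂ (inj₁ tx) = separated (sides⇒joined (Edge-sym E) sx tx)
    ... | inj₂ (inj₂ sy) | inj₂ (inj₂ ty) = separated (sides⇒joined (Edge-sym E) sy ty)
    ... | inj₂ (inj₁ sx) | inj₂ (inj₂ ty) = oriented new (inj₁ (here refl)) S lt separated sx ty
    ... | inj₂ (inj₂ sy) | inj₂ (inj₁ tx) = oriented (New-sym new) (inj₂ (here refl)) S lt separated sy tx

-- Connectivity

fromList : ∀ {n} → List (Fin n) → Subset n
fromList []      = Subset.⊥
fromList (v ∷ S) = ⁅ v ⁆ ∪ fromList S

∣⁅x⁆∪p∣≤1+∣p∣ : ∀ {n} (x : Fin n) (p : Subset n) → ∣ ⁅ x ⁆ ∪ p ∣ ℕ.≤ suc ∣ p ∣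
∣⁅x⁆∪p∣≤1+∣p∣ zero (b ∷ᵥ p) = s≤s (ℕ.≤-trans (ℕ.≤-reflexive (cong ∣_∣ (Subset.∪-identityˡ p))) (Subset.∣p∣≤∣x∷p∣ b p))
∣⁅x⁆∪p∣≤1+∣p∣ (suc x) (Subset.inside ∷ᵥ p) = s≤s (∣⁅x⁆∪p∣≤1+∣p∣ x p)
∣⁅x⁆∪p∣≤1+∣p∣ (suc x) (Subset.outside ∷ᵥ p) = ∣⁅x⁆∪p∣≤1+∣p∣ x p

∣fromList∣≤length : ∀ {n} (S : List (Fin n)) → ∣ fromList S ∣ ℕ.≤ length S
∣fromList∣≤length {n} [] = ℕ.≤-reflexive (Subset.∣⊥∣≡0 n)
∣fromList∣≤length (v ∷ S) = ℕ.≤-trans (∣⁅x⁆∪p∣≤1+∣p∣ v (fromList S)) (s≤s (∣fromList∣≤length S))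

∈-fromList⁻ : ∀ {n} {v : Fin n} S → v ∈ₛ fromList S → v ∈ S
∈-fromList⁻ []      v∈ = ⊥-elim (Subset.∉⊥ v∈)
∈-fromList⁻ (u ∷ S) v∈ with Subset.x∈p∪q⁻ ⁅ u ⁆ (fromList S) v∈
... | inj₁ v∈u = here (Subset.x∈⁅y⁆⇒x≡y u v∈u)
... | inj₂ v∈S = there (∈-fromList⁻ S v∈S)

∈-fromList⁺ : ∀ {n} {v : Fin n} {S} → v ∈ S → v ∈ₛ fromList S
∈-fromList⁺ (here refl) = Subset.x∈p∪q⁺ (inj₁ (Subset.x∈⁅x⁆ _))
∈-fromList⁺ (there v∈S) = Subset.x∈p∪q⁺ (inj₂ (∈-fromList⁺ v∈S))

x∉p-x : ∀ {n} {x : Fin n} (p : Subset n) → x ∉ₛ p Subset.- x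
x∉p-x {x = zero}  (Subset.inside ∷ᵥ p)  ()
x∉p-x {x = zero}  (Subset.outside ∷ᵥ p) ()
x∉p-x {x = suc x} (Subset.inside ∷ᵥ p)  (thereᵥ x∈) = x∉p-x p x∈
x∉p-x {x = suc x} (Subset.outside ∷ᵥ p) (thereᵥ x∈) = x∉p-x p x∈

module MapReach {n} (M : Map n) where
  open Map M
  open MapProperties M

  reach⇒conn : ∀ {X : Subset n} {u v} → Reach X u v → Conn Adj (_∈ₛ X) u v
  reach⇒conn (here u∈)     = end u∈
  reach⇒conn (step u∈ a r) = hop u∈ a (reach⇒conn r)

  conn⇒reach : ∀ {X : Subset n} {u v} → Conn Adj (_∈ₛ X) u v → Reach X u v
  conn⇒reach (end u∈)     = here u∈
  conn⇒reach (hop u∈ a c) = step u∈ a (conn⇒reach c)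

  Out : Subset n → Fin n → Fin n → Set
  Out S = Conn Adj (_∉ₛ S)

  reach⇒out : ∀ {S : Subset n} {u v} → Reach (∁ S) u v → Out S u v
  reach⇒out r = Conn-map id Subset.x∈∁p⇒x∉p (reach⇒conn r)

  out⇒reach : ∀ {S : Subset n} {u v} → Out S u v → Reach (∁ S) u v
  out⇒reach c = conn⇒reach (Conn-map id Subset.x∉p⇒x∈∁p c)

  Adj? : ∀ u v → Dec (Adj u v)
  Adj? u v = Fin.any? (λ x → (tail x Fin.≟ u) ×-dec (head x Fin.≟ v))

  -- The walk is cut after its last visit to `u`. A search from `u` may thus delete `u` before
  -- continuing from a neighbour, so connection is decidable by recursion on the size of `X`.
  leave : ∀ {X : Subset n} u {w v} → Conn Adj (_∈ₛ X) w v →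
    u ≡ v ⊎ Conn Adj (_∈ₛ X Subset.- u) w v ⊎ (∃ λ w′ → Adj u w′ × Conn Adj (_∈ₛ X Subset.- u) w′ v)
  leave u (end {w} w∈) with w Fin.≟ u
  ... | yes refl = inj₁ refl
  ... | no w≢u   = inj₂ (inj₁ (end (Subset.x∈p∧x≢y⇒x∈p-y w∈ w≢u)))
  leave u (hop {w} w∈ a c) with leave u c
  ... | inj₁ eq        = inj₁ eq
  ... | inj₂ (inj₂ c′) = inj₂ (inj₂ c′)
  ... | inj₂ (inj₁ c′) with w Fin.≟ u
  ...   | yes refl = inj₂ (inj₂ (_ , a , c′))
  ...   | no w≢u   = inj₂ (inj₁ (hop (Subset.x∈p∧x≢y⇒x∈p-y w∈ w≢u) a c′))

  private
    conn?-bounded : ∀ k (X : Subset n) → ∣ X ∣ ℕ.< k → ∀ u v → Dec (Conn Adj (_∈ₛ X) u v)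
    conn?-bounded (suc k) X (s≤s |X|≤k) u v with u Subset.∈? X
    ... | no u∉ = no (u∉ ∘ Conn-source)
    ... | yes u∈ with u Fin.≟ v
    ...   | yes refl = yes (end u∈)
    ...   | no u≢v with Fin.any? (λ w → Adj? u w ×-dec conn?-bounded k (X Subset.- u) (ℕ.<-≤-trans (Subset.x∈p⇒∣p-x∣<∣p∣ u∈) |X|≤k) w v)
    ...     | yes (w , a , c) = yes (hop u∈ a (Conn-map id (Subset.p─q⊆p X ⁅ u ⁆) c))
    ...     | no ¬w = no refute
      where
      refute : ¬ Conn Adj (_∈ₛ X) u v
      refute c with leave u c
      ... | inj₁ u≡v         = u≢v u≡v
      ... | inj₂ (inj₂ w)    = ¬w w
      ... | inj₂ (inj₁ c′)   = x∉p-x X (Conn-source c′)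

  conn? : ∀ (X : Subset n) u v → Dec (Conn Adj (_∈ₛ X) u v)
  conn? X = conn?-bounded (suc ∣ X ∣) X ℕ.≤-refl

  out? : ∀ (S : Subset n) u v → Dec (Out S u v)
  out? S u v with conn? (∁ S) u v
  ... | yes c = yes (Conn-map id Subset.x∈∁p⇒x∉p c)
  ... | no ¬c = no (¬c ∘ Conn-map id Subset.x∉p⇒x∈∁p)

  out-sym : ∀ {S : Subset n} {u v} → Out S u v → Out S v u
  out-sym = Conn-sym Adj-sym

  out-mono : ∀ {S T : Subset n} → T Subset.⊆ S → ∀ {u v} → Out S u v → Out T u v
  out-mono T⊆S = Conn-map id (λ w∉S w∈T → w∉S (T⊆S w∈T))

  -- The first vertex of `S` on a walk from `u` that avoids `S` without `s` can only be `s`, and its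
  -- predecessor lies in the component of `u`.
  separator-adjacent : ∀ {S : Subset n} {s u v} → u ∉ₛ S → ¬ Out S u v → Out (S Subset.- s) u v → ∃ λ w → Adj s w × Out S u w
  separator-adjacent {S} {s} {u} {v} u∉S ¬uv = go (end u∉S)
    where
    go : ∀ {w} → Out S u w → Out (S Subset.- s) w v → ∃ λ w → Adj s w × Out S u w
    go uw (end _) = ⊥-elim (¬uv uw)
    go uw (hop {w = w} _ a c) with w Subset.∈? S
    ... | no w∉S = go (uw ++ᶜ hop (Conn-target uw) a (end w∉S)) c
    ... | yes w∈S with w Fin.≟ s
    ...   | yes refl = _ , Adj-sym a , uw
    ...   | no w≢s = ⊥-elim (Conn-source c (Subset.x∈p∧x≢y⇒x∈p-y w∈S w≢s))

-- Cycles and faces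

module Chains {n} (M : Map n) where
  open Map M
  open MapProperties M

  abstract
    arc : Fin d → Fin d → ℤ
    arc x y = δ x y - δ (rev x) y

    ∑-arc : ∀ x h → ∑ (λ y → arc x y * h y) ≡ ∇ h x
    ∑-arc x h = trans (dot-- (δ x) (δ (rev x)) h) (cong₂ _-_ (∑-δ x h) (∑-δ (rev x) h))

    δ-rev : ∀ x y → δ x (rev y) ≡ δ (rev x) y
    δ-rev x y with x Fin.≟ rev y
    ... | yes refl = trans (δ-refl (rev y)) (sym (trans (cong (λ z → δ z y) (rev-inv y)) (δ-refl y)))
    ... | no x≢ = trans (δ-≢ x≢) (sym (δ-≢ λ eq → x≢ (trans (sym (rev-inv x)) (cong rev eq))))

    arc-antisym : ∀ x → Antisymmetric (arc x)
    arc-antisym x y = trans (cong₂ _-_ (δ-rev x y) (trans (δ-rev (rev x) y) (cong (λ z → δ z y) (rev-inv x)))) (swap (δ (rev x) y) (δ x y))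
      where
      swap : ∀ a b → a - b ≡ - (b - a)
      swap = solve-∀

    arc-self : ∀ x → arc x x ≡ 1ℤ
    arc-self x = cong₂ _-_ (δ-refl x) (δ-≢ (rev-fp x))

    arc-off : ∀ {x y} → x ≢ y → rev x ≢ y → arc x y ≡ 0ℤ
    arc-off x≢y rx≢y = cong₂ _-_ (δ-≢ x≢y) (δ-≢ rx≢y)

    arc-elsewhere : ∀ {x y} → tail y ≢ tail x → tail y ≢ head x → arc x y ≡ 0ℤ
    arc-elsewhere {x} {y} y≢t y≢h = arc-off {x} {y} (λ { refl → y≢t refl }) (λ { refl → y≢h refl })

    chain : ∀ {Q u v} → Conn Adj Q u v → Fin d → ℤ
    chain (end _)           y = 0ℤ
    chain (hop _ (x , _) p) y = arc x y + chain p y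

    chain-antisym : ∀ {Q u v} (p : Conn Adj Q u v) → Antisymmetric (chain p)
    chain-antisym (end _)           y = refl
    chain-antisym (hop _ (x , _) p) y = trans (cong₂ _+_ (arc-antisym x y) (chain-antisym p y)) (sym (ℤ.neg-distrib-+ (arc x y) (chain p y)))

    ∑-chain : ∀ {Q u v} (p : Conn Adj Q u v) (f : Fin n → ℤ) → ∑ (λ y → chain p y * f (tail y)) ≡ f u - f v
    ∑-chain {u = u} (end _) f = trans (∑-zero (λ _ → refl)) (sym (ℤ.i≡j⇒i-j≡0 (refl {x = f u})))
    ∑-chain (hop {v = v} _ (x , refl , refl) p) f = begin
      ∑ (λ y → (arc x y + chain p y) * f (tail y))    ≡⟨ dot-+ (arc x) (chain p) (f ∘ tail) ⟩
      ∑ (λ y → arc x y * f (tail y)) + ∑ (λ y → chain p y * f (tail y)) ≡⟨ cong₂ _+_ (∑-arc x (f ∘ tail)) (∑-chain p f) ⟩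
      f (tail x) - f (head x) + (f (head x) - f v)    ≡⟨ telescope (f (tail x)) (f (head x)) (f v) ⟩
      f (tail x) - f v                                ∎
      where
      telescope : ∀ a b c → a - b + (b - c) ≡ a - c
      telescope = solve-∀

    chain-off : ∀ {Q u v} (p : Conn Adj Q u v) {y} → ¬ Q (tail y) → chain p y ≡ 0ℤ
    chain-off (end _) ¬q = refl
    chain-off {Q} (hop q (x , refl , refl) p) {y} ¬q = cong₂ _+_
      (arc-elsewhere {x} {y} (λ eq → ¬q (subst Q (sym eq) q)) (λ eq → ¬q (subst Q (sym eq) (Conn-source p)))) (chain-off p ¬q)

    -- The chain of a walk from tail p to tail q that starts with p and ends with rev q.
    strand : ∀ {Q} (p q : Fin d) → Conn Adj Q (head p) (head q) → Fin d → ℤ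
    strand p q c y = arc p y + chain c y - arc q y

    strand-antisym : ∀ {Q} p q (c : Conn Adj Q (head p) (head q)) → Antisymmetric (strand p q c)
    strand-antisym p q c y = trans (cong₂ _-_ (cong₂ _+_ (arc-antisym p y) (chain-antisym c y)) (arc-antisym q y)) (negate (arc p y) (chain c y) (arc q y))
      where
      negate : ∀ a b c → - a + - b - - c ≡ - (a + b - c)
      negate = solve-∀

    ∑-strand : ∀ {Q} p q (c : Conn Adj Q (head p) (head q)) (f : Fin n → ℤ) →
      ∑ (λ y → strand p q c y * f (tail y)) ≡ f (tail p) - f (tail q)
    ∑-strand p q c f = begin
      ∑ (λ y → (arc p y + chain c y - arc q y) * f (tail y))
        ≡⟨ dot-- (λ y → arc p y + chain c y) (arc q) (f ∘ tail) ⟩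
      dot (λ y → arc p y + chain c y) (f ∘ tail) - dot (arc q) (f ∘ tail)
        ≡⟨ cong₂ _-_ (trans (dot-+ (arc p) (chain c) (f ∘ tail)) (cong₂ _+_ (∑-arc p (f ∘ tail)) (∑-chain c f))) (∑-arc q (f ∘ tail)) ⟩
      (f (tail p) - f (head p)) + (f (head p) - f (head q)) - (f (tail q) - f (head q))
        ≡⟨ telescope (f (tail p)) (f (head p)) (f (head q)) (f (tail q)) ⟩
      f (tail p) - f (tail q) ∎
      where
      telescope : ∀ a b c e → (a - b) + (b - c) - (e - c) ≡ a - e
      telescope = solve-∀

    strand-off : ∀ {Q} p q (c : Conn Adj Q (head p) (head q)) {y} → ¬ Q (tail y) → p ≢ y → q ≢ y →
      strand p q c y ≡ 0ℤ
    strand-off {Q} p q c {y} ¬q p≢y q≢y = cong₂ _-_ (cong₂ _+_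
      (arc-off {p} p≢y (λ { refl → ¬q (Conn-source c) })) (chain-off c ¬q)) (arc-off {q} q≢y (λ { refl → ¬q (Conn-target c) }))

    strand-source : ∀ {Q} p q (c : Conn Adj Q (head p) (head q)) → ¬ Q (tail p) → p ≢ q → strand p q c p ≡ 1ℤ
    strand-source p q c ¬q p≢q = cong₂ _-_ (cong₂ _+_ (arc-self p) (chain-off c ¬q))
      (arc-off {q} (p≢q ∘ sym) (λ { refl → ¬q (Conn-target c) }))

    strand-target : ∀ {Q} p q (c : Conn Adj Q (head p) (head q)) → ¬ Q (tail q) → p ≢ q → strand p q c q ≡ ℤ.-1ℤ
    strand-target p q c ¬q p≢q = cong₂ _-_ (cong₂ _+_ (arc-off {p} p≢q (λ { refl → ¬q (Conn-source c) }))
      (chain-off c ¬q)) (arc-self q)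

  -- The darts met when rotating from a on, where p and q may only be met as the last dart.
  data Turn (p q a : Fin d) : Fin d → Set where
    stay : Turn p q a a
    turn : ∀ {w} → Turn p q a w → w ≢ p → w ≢ q → Turn p q a (rot w)

  Turn-swap : ∀ {p q a w} → Turn p q a w → Turn q p a w
  Turn-swap stay           = stay
  Turn-swap (turn t ≢p ≢q) = turn (Turn-swap t) ≢q ≢p

  -- Rotation from `rot p` reaches every dart at the vertex; the record is restarted at `rot p` or
  -- `rot q` whenever `p` or `q` has just been passed.
  turns : ∀ p q w → tail w ≡ tail p → Turn p q (rot p) w ⊎ Turn p q (rot q) w
  turns p q w tw with k , refl ← rot-trans (rot p) w (trans (rot-tail p) (sym tw)) = go k
    where
    go : ∀ k → Turn p q (rot p) (iter rot k (rot p)) ⊎ Turn p q (rot q) (iter rot k (rot p))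
    go zero = inj₁ stay
    go (suc k) with iter rot k (rot p) Fin.≟ p | iter rot k (rot p) Fin.≟ q
    ... | yes eq | _ = inj₁ (subst (Turn p q (rot p)) (cong rot (sym eq)) stay)
    ... | no _ | yes eq = inj₂ (subst (Turn p q (rot q)) (cong rot (sym eq)) stay)
    ... | no ≢p | no ≢q with go k
    ...   | inj₁ t = inj₁ (turn t ≢p ≢q)
    ...   | inj₂ t = inj₂ (turn t ≢p ≢q)

  Turn-blocked : ∀ {p q w} → Turn p q q w → w ≡ q
  Turn-blocked stay = refl
  Turn-blocked (turn t _ ≢q) = contradiction (Turn-blocked t) ≢q

  Turn-tail : ∀ {p q a w} → Turn p q a w → tail w ≡ tail a
  Turn-tail stay = refl
  Turn-tail (turn t _ _) = trans (rot-tail _) (Turn-tail t)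

  Turn-constant : ∀ {p q a w} {g : Fin d → ℤ} → (∀ w → tail w ≡ tail a → w ≢ p → w ≢ q → g (rot w) ≡ g w) → Turn p q a w → g w ≡ g a
  Turn-constant still stay = refl
  Turn-constant still (turn t ≢p ≢q) = trans (still _ (Turn-tail t) ≢p ≢q) (Turn-constant still t)

-- Face functions around a vertex, and the shape of faces

record FourConnected {n} (M : Map n) : Set where
  field
    4-connected : Map.KConnected M 4

module Plane {n} (M : Map n) (spherical : Spherical M) (fourConnected : FourConnected M) where
  open Map M
  open FourConnected fourConnected
  open MapProperties M
  open MapReach M
  open Chains M
  open Hodge M spherical

  outside-list : ∀ (S : List (Fin n)) → length S ℕ.< 4 → ∀ {u v} → u ∉ S → v ∉ S → Conn Adj (_∉ S) u v
  outside-list S lt u∉ v∉ = Conn-map id (_∘ ∈-fromList⁺) (reach⇒out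
    (proj₂ 4-connected (fromList S) (ℕ.≤-<-trans (∣fromList∣≤length S) lt) _ _
      (Subset.x∉p⇒x∈∁p (u∉ ∘ ∈-fromList⁻ S)) (Subset.x∉p⇒x∈∁p (v∉ ∘ ∈-fromList⁻ S))))

  fresh : ∀ (S : List (Fin n)) → length S ℕ.≤ 4 → ∃ λ v → v ∉ S
  fresh S le with Fin.any? (λ v → ¬? (any? (v Fin.≟_) S))
  ... | yes found = found
  ... | no ¬found = contradiction (injection-length S id (λ v → listed v) id) (ℕ.<⇒≱ (ℕ.≤-<-trans le (proj₁ 4-connected)))
    where
    listed : ∀ v → v ∈ S
    listed v with any? (v Fin.≟_) S
    ... | yes v∈ = v∈
    ... | no v∉ = contradiction (v , v∉) ¬found

  connected : ∀ u v → Conn Adj (λ _ → ⊤) u v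
  connected u v = Conn-map id (λ _ → tt) (outside-list [] (s≤s z≤n) {u} {v} (λ ()) (λ ()))

  abstract
    v₀ : Fin n
    v₀ = proj₁ (fresh [] z≤n)

    x₀ : Fin d
    x₀ with v , v∉ ← fresh (v₀ ∷ []) (s≤s z≤n) with connected v v₀
    ... | end _           = contradiction (here refl) v∉
    ... | hop _ (x , _) _ = x

  -- As `rot x` lies on the face of `rev x`, turning from `x` to `rot x` crosses the edge of `x`. In
  -- this form the equation says by how much `g` changes when rotating about a vertex.
  boundary : ∀ {ω} → Antisymmetric ω → (∀ (f : Fin n → ℤ) → ∑ (λ x → ω x * f (tail x)) ≡ 0ℤ) →
    ∃ λ c → ∃ λ g → 0ℤ ℤ.< c × FaceInvariant g × (∀ x → c * ω x ≡ g x - g (rot x))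
  boundary anti cyc with c , g , c>0 , inv , eq ← cycle⇒boundary connected v₀ x₀ anti cyc =
    c , g , c>0 , inv , λ x → trans (eq x) (cong (λ e → g x - e) (trans (sym (inv (rev x))) (cong g (face-rev x))))

  module _ {c : ℤ} {ω g : Fin d → ℤ} (eq : ∀ x → c * ω x ≡ g x - g (rot x)) where
    flat : ∀ {x} → ω x ≡ 0ℤ → g (rot x) ≡ g x
    flat {x} ω≡0 = sym (ℤ.i-j≡0⇒i≡j (g x) (g (rot x)) (trans (sym (eq x)) (trans (cong (c *_) ω≡0) (ℤ.*-zeroʳ c))))

    drop : ∀ {x} → ω x ≡ 1ℤ → g x ≡ g (rot x) + c
    drop {x} ω≡1 = begin
      g x                            ≡⟨ split (g x) (g (rot x)) ⟩
      g (rot x) + (g x - g (rot x))  ≡⟨ cong (_+_ (g (rot x))) (sym (eq x)) ⟩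
      g (rot x) + c * ω x            ≡⟨ cong (λ e → g (rot x) + c * e) ω≡1 ⟩
      g (rot x) + c * 1ℤ             ≡⟨ cong (_+_ (g (rot x))) (ℤ.*-identityʳ c) ⟩
      g (rot x) + c                  ∎
      where
      split : ∀ a b → a ≡ b + (a - b)
      split = solve-∀

    rise : ∀ {x} → ω x ≡ ℤ.-1ℤ → g (rot x) ≡ g x + c
    rise {x} ω≡-1 = begin
      g (rot x)                      ≡⟨ split (g x) (g (rot x)) ⟩
      g x - (g x - g (rot x))        ≡⟨ cong (_-_ (g x)) (sym (eq x)) ⟩
      g x - c * ω x                  ≡⟨ cong (λ e → g x - c * e) ω≡-1 ⟩
      g x - c * ℤ.-1ℤ                ≡⟨ negate (g x) c ⟩
      g x + c                        ∎
      where
      split : ∀ a b → b ≡ a - (a - b)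
      split = solve-∀
      negate : ∀ a b → a - b * ℤ.-1ℤ ≡ a + b
      negate = solve-∀

  +-positive-≢ : ∀ {c} → 0ℤ ℤ.< c → ∀ a → a ≢ a + c
  +-positive-≢ {c} c>0 a eq = ℤ.<-irrefl (trans (ℤ.+-identityʳ a) eq) (ℤ.+-monoʳ-< a c>0)

  -- A closed walk leaving v through p and returning through q separates the two sectors into which p and q cut the faces around v.
  record Fork (Q : Fin n → Set) (p q : Fin d) : Set where
    field
      c       : ℤ
      g       : Fin d → ℤ
      c>0     : 0ℤ ℤ.< c
      g-inv   : FaceInvariant g
      g-p     : g p ≡ g (rot p) + c
      g-q     : g (rot q) ≡ g q + c
      g-at    : ∀ w → ¬ Q (tail w) → w ≢ p → w ≢ q → g (rot w) ≡ g w

  fork : ∀ {Q p q} → tail p ≡ tail q → p ≢ q → ¬ Q (tail p) → Conn Adj Q (head p) (head q) → Fork Q p q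
  fork {Q} {p} {q} tp≡tq p≢q ¬q conn = build (boundary (strand-antisym p q conn) (λ f → trans (∑-strand p q conn f) (ℤ.i≡j⇒i-j≡0 (cong f tp≡tq))))
    where
    build : (∃ λ c → ∃ λ g → 0ℤ ℤ.< c × FaceInvariant g × (∀ x → c * strand p q conn x ≡ g x - g (rot x))) → Fork Q p q
    build (c , g , c>0 , inv , eq) = record
      { c = c ; g = g ; c>0 = c>0 ; g-inv = inv
      ; g-p = drop {c} {strand p q conn} {g} eq (strand-source p q conn ¬q p≢q)
      ; g-q = rise {c} {strand p q conn} {g} eq (strand-target p q conn (subst (¬_ ∘ Q) tp≡tq ¬q) p≢q)
      ; g-at = λ w ¬qw w≢p w≢q → flat {c} {strand p q conn} {g} eq (strand-off p q conn ¬qw (w≢p ∘ sym) (w≢q ∘ sym))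
      }

  -- A face visiting v twice would make v a cut vertex.
  tail-injective : ∀ {x y} → SameFace x y → tail x ≡ tail y → x ≡ y
  tail-injective {x} {y} same tx≡ty with x Fin.≟ y
  ... | yes x≡y = x≡y
  ... | no x≢y = ⊥-elim (go (turns x y y (sym tx≡ty)))
    where
    head∉ : ∀ {z} → tail z ≡ tail x → head z ∉ tail x ∷ []
    head∉ {z} tz (here eq) = no-loop z (trans eq (sym tz))
    open Fork (fork {_∉ tail x ∷ []} tx≡ty x≢y (λ ∉ → ∉ (here refl)) (outside-list (tail x ∷ []) (s≤s (s≤s z≤n)) (head∉ refl) (head∉ (sym tx≡ty))))
    still : ∀ a → tail a ≡ tail x → ∀ w → tail w ≡ tail a → w ≢ x → w ≢ y → g (rot w) ≡ g w
    still a ta w tw = g-at w (λ ∉ → ∉ (here (trans tw ta)))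
    go : ¬ (Turn x y (rot x) y ⊎ Turn x y (rot y) y)
    -- If `y` closes the sector after `x`, its value is that of `rot x`; sharing the face of `x`, it
    -- also has the value of `x`, which is larger by `c`.
    go (inj₁ t) = +-positive-≢ c>0 (g y) (trans (sym (FaceInvariant-SameFace g-inv same))
      (trans g-p (cong (_+ c) (sym (Turn-constant (still (rot x) (rot-tail x)) t)))))
    go (inj₂ t) = +-positive-≢ c>0 (g y) (trans (Turn-constant (still (rot y) (trans (rot-tail y) (sym tx≡ty))) t) g-q)

  -- A dart fixed by the rotation would be the only one at its tail, and deleting its head would cut
  -- that tail off from a third vertex.
  rot-moves : ∀ x → rot x ≢ x
  rot-moves x fixed with w , w∉ ← fresh (tail x ∷ head x ∷ []) (s≤s (s≤s z≤n)) =
    escape (outside-list (head x ∷ []) (s≤s (s≤s z≤n)) (λ { (here eq) → no-loop x (sym eq) }) (w∉ ∘ there))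
    where
    only : ∀ z → tail z ≡ tail x → z ≡ x
    only z tz with k , refl ← rot-trans x z (sym tz) = go k
      where
      go : ∀ k → iter rot k x ≡ x
      go zero    = refl
      go (suc k) = trans (cong rot (go k)) fixed
    escape : ¬ Conn Adj (_∉ head x ∷ []) (tail x) w
    escape (end _) = w∉ (here refl)
    escape (hop _ (z , tz , refl) c) = Conn-source c (here (cong head (only z tz)))

  -- In a face of length two, `face x` and `rev x` would be parallel, hence equal by simplicity, and
  -- `rev x` would be fixed by `rot`.
  face²-moves : ∀ x → face (face x) ≢ x
  face²-moves x eq = rot-moves (rev x) (no-multi (face x) (rev x) (tail-face x)
    (trans (sym (tail-face (face x))) (trans (cong tail eq) (sym (head-rev x)))))

  face-moves : ∀ x → face x ≢ x
  face-moves x eq = no-loop x (trans (sym (tail-face x)) (cong tail eq))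

  small⇒triangle : ∀ x → ¬ LargeFace x → face (face (face x)) ≡ x
  small⇒triangle x small with face (face (face x)) Fin.≟ x
  ... | yes eq = eq
  ... | no face³≢ = contradiction (injection-count (SameFace? x) (λ (i : Fin 4) → iter face (toℕ i) x) (λ i → sameFace (toℕ i) refl) inj) small
    where
    moves : ∀ m → 0 ℕ.< m → m ℕ.< 4 → iter face m x ≢ x
    moves 1 _ _ = face-moves x
    moves 2 _ _ = face²-moves x
    moves 3 _ _ = face³≢
    moves (suc (suc (suc (suc _)))) _ (s≤s (s≤s (s≤s (s≤s ()))))
    ordered : ∀ {i j : Fin 4} → toℕ i ℕ.< toℕ j → iter face (toℕ i) x ≢ iter face (toℕ j) x
    ordered {i} {j} i<j eq = moves (toℕ j ℕ.∸ toℕ i) (ℕ.m<n⇒0<n∸m i<j) (ℕ.≤-<-trans (ℕ.m∸n≤m (toℕ j) (toℕ i)) (Fin.toℕ<n j))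
      (iter-cancel face face-injective x (ℕ.<⇒≤ i<j) eq)
    inj : ∀ {i j : Fin 4} → iter face (toℕ i) x ≡ iter face (toℕ j) x → i ≡ j
    inj {i} {j} eq with ℕ.<-cmp (toℕ i) (toℕ j)
    ... | tri< i<j _ _ = contradiction eq (ordered {i} {j} i<j)
    ... | tri≈ _ i≡j _ = Fin.toℕ-injective i≡j
    ... | tri> _ _ j<i = contradiction (sym eq) (ordered {j} {i} j<i)

-- Crossing a closed curve, and orientations of attachments

module Crossing {n} (M : Map n) (spherical : Spherical M) (fourConnected : FourConnected M) where
  open Map M
  open MapProperties M
  open Chains M
  open Plane M spherical fourConnected

  star : ∀ {g : Fin d → ℤ} {v} → (∀ w → tail w ≡ v → g (rot w) ≡ g w) → ∀ {a b} → tail a ≡ v → tail b ≡ v → g a ≡ g b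
  star {g} still {a} {b} ta tb with k , refl ← rot-trans a b (trans ta (sym tb)) = go k
    where
    iter-tail : ∀ k → tail (iter rot k a) ≡ tail a
    iter-tail zero    = refl
    iter-tail (suc k) = trans (rot-tail _) (iter-tail k)
    go : ∀ k → g a ≡ g (iter rot k a)
    go zero    = refl
    go (suc k) = trans (go k) (sym (still _ (trans (iter-tail k) ta)))

  FaceInvariant-rev : ∀ {g} → FaceInvariant g → ∀ a → g (rev a) ≡ g (rot a)
  FaceInvariant-rev {g} inv a = trans (sym (inv (rev a))) (cong g (face-rev a))

  along : ∀ {g : Fin d → ℤ} {Q : Fin n → Set} → FaceInvariant g → (∀ w → Q (tail w) → g (rot w) ≡ g w) →
    ∀ {u v} → Conn Adj Q u v → ∀ {a b} → tail a ≡ u → tail b ≡ v → g a ≡ g b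
  along {g} {Q} inv still (end q) ta tb = star (λ w tw → still w (subst Q (sym tw) q)) ta tb
  along {g} {Q} inv still (hop q (e , refl , he) p) {a} ta tb =
    trans (star (λ w tw → still w (subst Q (sym tw) q)) ta refl)
      (trans (trans (sym (still e q)) (sym (FaceInvariant-rev inv e))) (along inv still p he tb))

  -- Closing the curve at tail y gives a cycle along two consecutive edges of the face of y. A face function bounded by
  -- it keeps its value along aside, but changes it on the way from y to the walk through.
  cross : ∀ {Q : Fin n → Set} y → ¬ Q (tail y) → Conn Adj Q (head y) (tail (face⁻¹ y)) →
    ∀ {y′ z z′} → SameFace y y′ → SameFace z z′ → ¬ SameFace y z →
    Conn Adj (λ w → ¬ Q w) (tail y) (tail z) → ¬ Conn Adj (λ w → ¬ Q w × w ≢ tail y) (tail y′) (tail z′)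
  cross {Q} y ¬Qv curve {y′} {z} {z′} y~y′ z~z′ y≁z through aside = impossible (fork {Q} {y} {q} (sym tail-q) y≢q ¬Qv curve)
    where
    q = rot⁻¹ y
    v = tail y

    tail-q : tail q ≡ v
    tail-q = trans (sym (rot-tail q)) (cong tail (rot-inv₁ y))

    y≢q : y ≢ q
    y≢q eq = rot-moves y (trans (cong rot eq) (rot-inv₁ y))

    impossible : ¬ Fork Q y q
    impossible F = +-positive-≢ c>0 (g (rot y)) (trans (proj₂ (sweep through refl) refl) (trans (sym gy≡gz) g-p))
      where
      open Fork F

      still : ∀ w → ¬ Q (tail w) → tail w ≢ v → g (rot w) ≡ g w
      still w ¬Qw w≢v = g-at w ¬Qw (w≢v ∘ cong tail) (λ eq → w≢v (trans (cong tail eq) tail-q))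

      gy≡gz : g y ≡ g z
      gy≡gz = trans (FaceInvariant-SameFace g-inv y~y′)
        (trans (along {Q = λ w → ¬ Q w × w ≢ v} g-inv (λ w (¬Qw , w≢v) → still w ¬Qw w≢v) aside refl refl)
          (sym (FaceInvariant-SameFace g-inv z~z′)))

      -- As `rot q` is `y`, the sector after `q` consists of `y` alone; all other darts at `v` lie
      -- in the sector after `y`.
      at-v : ∀ w → tail w ≡ v → w ≢ y → g w ≡ g (rot y)
      at-v w tw w≢y with turns y q w tw
      ... | inj₁ t = Turn-constant {g = g} (λ x tx x≢y x≢q → g-at x (λ Qx → ¬Qv (subst Q (trans tx (rot-tail y)) Qx)) x≢y x≢q) t
      ... | inj₂ t = contradiction (Turn-blocked (Turn-swap (subst (λ a → Turn y q a w) (rot-inv₁ y) t))) w≢y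

      avoid-y : ∀ {e} → ¬ Q (head e) → e ≢ y
      avoid-y ¬Qh refl = ¬Qh (Conn-source curve)

      -- The walk may return to `v`, where `g` takes two values. At `v` the claim therefore concerns
      -- the value at `rot y`, the one seen by every dart along which the walk enters or leaves:
      -- neither `y` nor `q` can be used, their heads lying in `Q`.
      sweep : ∀ {w w′} → Conn Adj (λ w → ¬ Q w) w w′ → tail z ≡ w′ →
        (w ≢ v → ∀ a → tail a ≡ w → g a ≡ g z) × (w ≡ v → g (rot y) ≡ g z)
      sweep {w} (end ¬Qw) tz =
        (λ w≢v a ta → star (λ x tx → still x (subst (¬_ ∘ Q) (sym tx) ¬Qw) (w≢v ∘ trans (sym tx))) ta tz) ,
        (λ w≡v → sym (at-v z (trans tz w≡v) λ { refl → y≁z (sameFace 0 refl) }))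
      sweep {w} (hop ¬Qw (e , refl , refl) p) tz = away , there-v
        where
        reached : g (rev e) ≡ g z
        reached with head e Fin.≟ v
        ... | no h≢v = proj₁ (sweep p tz) h≢v (rev e) refl
        ... | yes h≡v = trans (at-v (rev e) h≡v (avoid-y (subst (¬_ ∘ Q) (sym (head-rev e)) ¬Qw))) (proj₂ (sweep p tz) h≡v)
        away : tail e ≢ v → ∀ a → tail a ≡ tail e → g a ≡ g z
        away w≢v a ta = trans (star (λ x tx → still x (subst (¬_ ∘ Q) (sym tx) ¬Qw) (w≢v ∘ trans (sym tx))) ta refl)
          (trans (trans (sym (still e ¬Qw w≢v)) (sym (FaceInvariant-rev g-inv e))) reached)
        there-v : tail e ≡ v → g (rot y) ≡ g z
        there-v w≡v = trans (sym (at-v e w≡v (avoid-y (Conn-source p))))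
          (trans (sym (g-at e ¬Qw (avoid-y (Conn-source p)) λ { refl → Conn-source p (Conn-target curve) }))
            (trans (sym (FaceInvariant-rev g-inv e)) reached))

  abstract
    step⁺ : ℤ → ℤ → ℤ
    step⁺ γ a with γ ℤ.<? a
    ... | yes _ = 1ℤ
    ... | no _  = 0ℤ

    step⁺-above : ∀ γ a → γ ℤ.< a → step⁺ γ a ≡ 1ℤ
    step⁺-above γ a γ<a with γ ℤ.<? a
    ... | yes _  = refl
    ... | no γ≮a = contradiction γ<a γ≮a

    step⁺-below : ∀ γ a → a ℤ.≤ γ → step⁺ γ a ≡ 0ℤ
    step⁺-below γ a a≤γ with γ ℤ.<? a
    ... | yes γ<a = contradiction γ<a (ℤ.≤⇒≯ a≤γ)
    ... | no _    = refl

    indicator : ∀ {P : Fin n → Set} → Decidable P → Fin n → ℤ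
    indicator P? v with P? v
    ... | yes _ = 1ℤ
    ... | no _  = 0ℤ

    indicator-yes : ∀ {P : Fin n → Set} (P? : Decidable P) {v} → P v → indicator P? v ≡ 1ℤ
    indicator-yes P? {v} p with P? v
    ... | yes _ = refl
    ... | no ¬p = contradiction p ¬p

    indicator-no : ∀ {P : Fin n → Set} (P? : Decidable P) {v} → ¬ P v → indicator P? v ≡ 0ℤ
    indicator-no P? {v} ¬p with P? v
    ... | yes p = contradiction p ¬p
    ... | no _  = refl

  -- A vertex, the common tail of three darts, with a neighbour in each of three sets. Three such
  -- vertices and three disjoint connected sets form a K₃,₃ minor.
  record Attachment (C D E : Fin n → Set) : Set where
    field
      c e f       : Fin d
      tail-e      : tail e ≡ tail c
      tail-f      : tail f ≡ tail c
      C-c         : C (head c)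
      D-e         : D (head e)
      E-f         : E (head f)
      outside-C   : ¬ C (tail c)
      outside-D   : ¬ D (tail c)
      outside-E   : ¬ E (tail c)

  record Apart (C D E : Fin n → Set) : Set where
    field
      connected-C : ∀ {u v} → C u → C v → Conn Adj C u v
      connected-D : ∀ {u v} → D u → D v → Conn Adj D u v
      connected-E : ∀ {u v} → E u → E v → Conn Adj E u v
      C-D         : ∀ {v} → C v → ¬ D v
      C-E         : ∀ {v} → C v → ¬ E v
      D-E         : ∀ {v} → D v → ¬ E v
      C-adj-D     : ∀ x → C (tail x) → ¬ D (head x)

  -- The two cyclic orders of the darts at the vertex: `c`, `f`, `e` and `c`, `e`, `f`.
  Positive Negative : ∀ {C D E} → Attachment C D E → Set
  Positive A = Turn c e (rot c) f where open Attachment A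
  Negative A = Turn c e (rot e) f where open Attachment A

  module _ {C D E : Fin n → Set} (C? : Decidable C) (apart : Apart C D E) where
    open Apart apart

    -- Let z be the closed walk t₁ C t₂ D t₁, and write a multiple of z as the boundary of a face function g.
    -- Around t₁ the function g is ≥ its value γ on the faces at E and around t₂ it is ≤ γ, so the boundary of the
    -- region g > γ is a cycle that crosses the edge boundary of C only at t₁, and there only once.
    positive-unique : (A₁ A₂ : Attachment C D E) → tail (Attachment.c A₁) ≢ tail (Attachment.c A₂) → Positive A₁ → ¬ Positive A₂
    positive-unique A₁ A₂ t₁≢t₂ turn₁ turn₂ = impossible (boundary ω-antisym ω-cycle)
      where
      open Attachment A₁ using () renaming (c to c₁; e to e₁; f to f₁)
      open Attachment A₂ using () renaming (c to c₂; e to e₂; f to f₂)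
      module A₁ = Attachment A₁
      module A₂ = Attachment A₂

      walkC : Conn Adj C (head c₁) (head c₂)
      walkC = connected-C A₁.C-c A₂.C-c

      walkD : Conn Adj D (head e₂) (head e₁)
      walkD = connected-D A₂.D-e A₁.D-e

      ω : Fin d → ℤ
      ω x = strand c₁ c₂ walkC x + strand e₂ e₁ walkD x

      ω-antisym : Antisymmetric ω
      ω-antisym x = trans (cong₂ _+_ (strand-antisym c₁ c₂ walkC x) (strand-antisym e₂ e₁ walkD x))
        (sym (ℤ.neg-distrib-+ (strand c₁ c₂ walkC x) (strand e₂ e₁ walkD x)))

      ω-cycle : ∀ (h : Fin n → ℤ) → ∑ (λ x → ω x * h (tail x)) ≡ 0ℤ
      ω-cycle h = begin
        ∑ (λ x → ω x * h (tail x))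
          ≡⟨ dot-+ (strand c₁ c₂ walkC) (strand e₂ e₁ walkD) (h ∘ tail) ⟩
        dot (strand c₁ c₂ walkC) (h ∘ tail) + dot (strand e₂ e₁ walkD) (h ∘ tail)
          ≡⟨ cong₂ _+_ (∑-strand c₁ c₂ walkC h) (∑-strand e₂ e₁ walkD h) ⟩
        h (tail c₁) - h (tail c₂) + (h (tail e₂) - h (tail e₁))
          ≡⟨ cong₂ (λ a b → h (tail c₁) - h (tail c₂) + (h a - h b)) A₂.tail-e A₁.tail-e ⟩
        h (tail c₁) - h (tail c₂) + (h (tail c₂) - h (tail c₁))
          ≡⟨ telescope (h (tail c₁)) (h (tail c₂)) ⟩
        0ℤ ∎
        where
        telescope : ∀ a b → a - b + (b - a) ≡ 0ℤ
        telescope = solve-∀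

      by-tail : ∀ {x y} → tail x ≢ tail y → x ≢ y
      by-tail t≢ refl = t≢ refl

      by-head : ∀ {P : Fin n → Set} {x y} → P (head x) → ¬ P (head y) → x ≢ y
      by-head p ¬p refl = ¬p p

      c₁≢c₂ : c₁ ≢ c₂
      c₁≢c₂ = by-tail t₁≢t₂
      e₂≢e₁ : e₂ ≢ e₁
      e₂≢e₁ = by-tail λ eq → t₁≢t₂ (trans (sym A₁.tail-e) (trans (sym eq) A₂.tail-e))
      e₂≢c₁ : e₂ ≢ c₁
      e₂≢c₁ = by-tail λ eq → t₁≢t₂ (trans (sym eq) A₂.tail-e)
      e₁≢c₂ : e₁ ≢ c₂
      e₁≢c₂ = by-tail λ eq → t₁≢t₂ (trans (sym A₁.tail-e) eq)
      e₁≢c₁ : e₁ ≢ c₁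
      e₁≢c₁ = by-head {D} A₁.D-e (C-D A₁.C-c)
      e₂≢c₂ : e₂ ≢ c₂
      e₂≢c₂ = by-head {D} A₂.D-e (C-D A₂.C-c)

      ω-c₁ : ω c₁ ≡ 1ℤ
      ω-c₁ = cong₂ _+_ (strand-source c₁ c₂ walkC A₁.outside-C c₁≢c₂) (strand-off e₂ e₁ walkD A₁.outside-D e₂≢c₁ e₁≢c₁)

      ω-c₂ : ω c₂ ≡ ℤ.-1ℤ
      ω-c₂ = cong₂ _+_ (strand-target c₁ c₂ walkC A₂.outside-C c₁≢c₂) (strand-off e₂ e₁ walkD A₂.outside-D e₂≢c₂ e₁≢c₂)

      ω-off : ∀ {x} → ¬ C (tail x) → ¬ D (tail x) → c₁ ≢ x → c₂ ≢ x → e₁ ≢ x → e₂ ≢ x → ω x ≡ 0ℤ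
      ω-off ¬C ¬D c₁≢ c₂≢ e₁≢ e₂≢ = cong₂ _+_ (strand-off c₁ c₂ walkC ¬C c₁≢ c₂≢) (strand-off e₂ e₁ walkD ¬D e₂≢ e₁≢)

      impossible : ¬ (∃ λ c → ∃ λ g → 0ℤ ℤ.< c × FaceInvariant g × (∀ x → c * ω x ≡ g x - g (rot x)))
      -- The coboundary of the indicator of `C` is orthogonal to the boundary of the region `g` >
      -- `γ`. Counted directly, however, their pairing is -2: one unit each from `c₁` and `rev c₁`,
      -- and nothing from any other dart.
      impossible (c , g , c>0 , inv , eq) = contradiction (trans (sym total) (∑-∇-∇ {F} {g⁺} (λ x → cong (indicator C?) (rot-tail x)) (λ x → cong (step⁺ γ) (inv x)))) λ ()
        where
        γ : ℤ
        γ = g f₁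
        g⁺ F : Fin d → ℤ
        g⁺ x = step⁺ γ (g x)
        F x = indicator C? (tail x)

        still : ∀ {x} → ω x ≡ 0ℤ → g (rot x) ≡ g x
        still = flat {c} {ω} {g} eq

        still₁ : ∀ x → tail x ≡ tail (rot c₁) → x ≢ c₁ → x ≢ e₁ → g (rot x) ≡ g x
        still₁ x tx x≢c₁ x≢e₁ = still (ω-off (subst (¬_ ∘ C) (sym t) A₁.outside-C) (subst (¬_ ∘ D) (sym t) A₁.outside-D)
          (x≢c₁ ∘ sym) (by-tail λ eq → t₁≢t₂ (trans (sym t) (sym eq))) (x≢e₁ ∘ sym) (by-tail λ eq → t₁≢t₂ (trans (sym t) (trans (sym eq) A₂.tail-e))))
          where t = trans tx (rot-tail c₁)

        still₂ : ∀ x → tail x ≡ tail (rot c₂) → x ≢ c₂ → x ≢ e₂ → g (rot x) ≡ g x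
        still₂ x tx x≢c₂ x≢e₂ = still (ω-off (subst (¬_ ∘ C) (sym t) A₂.outside-C) (subst (¬_ ∘ D) (sym t) A₂.outside-D)
          (by-tail λ eq → t₁≢t₂ (trans eq t)) (x≢c₂ ∘ sym) (by-tail λ eq → t₁≢t₂ (trans (sym A₁.tail-e) (trans eq t))) (x≢e₂ ∘ sym))
          where t = trans tx (rot-tail c₂)

        stillE : ∀ x → E (tail x) → g (rot x) ≡ g x
        stillE x Ex = still (ω-off (λ Cx → C-E Cx Ex) (λ Dx → D-E Dx Ex)
          (λ { refl → A₁.outside-E Ex }) (λ { refl → A₂.outside-E Ex })
          (λ { refl → A₁.outside-E (subst E A₁.tail-e Ex) }) (λ { refl → A₂.outside-E (subst E A₂.tail-e Ex) }))

        f₁-rev : g (rev f₁) ≡ g f₁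
        f₁-rev = trans (FaceInvariant-rev inv f₁) (still₁ f₁ (trans A₁.tail-f (sym (rot-tail c₁)))
          (by-head {E} A₁.E-f (C-E A₁.C-c)) (by-head {E} A₁.E-f (D-E A₁.D-e)))

        f₂-rev : g (rev f₂) ≡ g f₂
        f₂-rev = trans (FaceInvariant-rev inv f₂) (still₂ f₂ (trans A₂.tail-f (sym (rot-tail c₂)))
          (by-head {E} A₂.E-f (C-E A₂.C-c)) (by-head {E} A₂.E-f (D-E A₂.D-e)))

        -- The closed walk avoids the connected set `E`, so one threshold serves both attachments.
        γ₂ : g f₂ ≡ γ
        γ₂ = trans (sym f₂-rev) (trans (sym (along {Q = E} inv stillE (connected-E A₁.E-f A₂.E-f) {rev f₁} {rev f₂} refl refl)) f₁-rev)

        rot-c₁ : g (rot c₁) ≡ γ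
        rot-c₁ = sym (Turn-constant {g = g} still₁ turn₁)

        rot-c₂ : g (rot c₂) ≡ γ
        rot-c₂ = trans (sym (Turn-constant {g = g} still₂ turn₂)) γ₂

        g⁺-rev : ∀ x → g⁺ (rev x) ≡ g⁺ (rot x)
        g⁺-rev x = cong (step⁺ γ) (FaceInvariant-rev inv x)

        ∇g⁺-c₁ : ∇ g⁺ c₁ ≡ 1ℤ
        ∇g⁺-c₁ = cong₂ _-_
          (step⁺-above γ (g c₁) (subst₂ ℤ._<_ (ℤ.+-identityʳ γ) (trans (cong (_+ c) (sym rot-c₁)) (sym (drop {c} {ω} {g} eq ω-c₁))) (ℤ.+-monoʳ-< γ c>0)))
          (trans (g⁺-rev c₁) (step⁺-below γ (g (rot c₁)) (ℤ.≤-reflexive rot-c₁)))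

        -- Turning past `c₂` raises `g` to `γ`, whereas turning past `c₁` lowers it to `γ`; the
        -- strict threshold detects only the latter.
        ∇g⁺-c₂ : ∇ g⁺ c₂ ≡ 0ℤ
        ∇g⁺-c₂ = cong₂ _-_
          (step⁺-below γ (g c₂) (ℤ.<⇒≤ (subst₂ ℤ._<_ (ℤ.+-identityʳ (g c₂)) (trans (sym (rise {c} {ω} {g} eq ω-c₂)) rot-c₂) (ℤ.+-monoʳ-< (g c₂) c>0))))
          (trans (g⁺-rev c₂) (step⁺-below γ (g (rot c₂)) (ℤ.≤-reflexive rot-c₂)))

        -- Apart from `c₁` and `c₂`, a dart entering `C` is off the closed walk: its tail is not in
        -- `D`, as no edge joins `C` and `D`, and its head shows that it is neither `e₁` nor `e₂`.
        entering : ∀ x → ¬ C (tail x) → C (head x) → ∇ g⁺ x ≡ δ c₁ x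
        entering x ¬Ct Ch with c₁ Fin.≟ x
        ... | yes refl = trans ∇g⁺-c₁ (sym (δ-refl c₁))
        ... | no c₁≢x with c₂ Fin.≟ x
        ...   | yes refl = trans ∇g⁺-c₂ (sym (δ-≢ c₁≢c₂))
        ...   | no c₂≢x = trans (ℤ.i≡j⇒i-j≡0 (trans (sym (cong (step⁺ γ) (still (ω-off ¬Ct
                 (λ Dt → C-adj-D (rev x) Ch (subst D (sym (head-rev x)) Dt)) c₁≢x c₂≢x
                 (by-head {D} A₁.D-e (C-D Ch)) (by-head {D} A₂.D-e (C-D Ch)))))) (sym (g⁺-rev x)))) (sym (δ-≢ c₁≢x))

        pointwise : ∀ x → ∇ F x * ∇ g⁺ x ≡ - (δ c₁ x * 1ℤ + δ (rev c₁) x * 1ℤ)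
        pointwise x with C? (tail x) | C? (head x)
        ... | yes Ct | yes Ch = begin
          ∇ F x * ∇ g⁺ x  ≡⟨ cong (_* ∇ g⁺ x) (cong₂ _-_ (indicator-yes C? Ct) (indicator-yes C? Ch)) ⟩
          0ℤ              ≡⟨ cong₂ (λ a b → - (a * 1ℤ + b * 1ℤ)) (δ-≢ {i = c₁} {x} λ { refl → A₁.outside-C Ct }) (δ-≢ {i = rev c₁} {x} λ { refl → A₁.outside-C (subst C (head-rev c₁) Ch) }) ⟨
          - (δ c₁ x * 1ℤ + δ (rev c₁) x * 1ℤ) ∎
        ... | no ¬Ct | no ¬Ch = begin
          ∇ F x * ∇ g⁺ x  ≡⟨ cong (_* ∇ g⁺ x) (cong₂ _-_ (indicator-no C? ¬Ct) (indicator-no C? ¬Ch)) ⟩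
          0ℤ              ≡⟨ cong₂ (λ a b → - (a * 1ℤ + b * 1ℤ)) (δ-≢ {i = c₁} {x} λ { refl → ¬Ch A₁.C-c }) (δ-≢ {i = rev c₁} {x} λ { refl → ¬Ct A₁.C-c }) ⟨
          - (δ c₁ x * 1ℤ + δ (rev c₁) x * 1ℤ) ∎
        ... | no ¬Ct | yes Ch = begin
          ∇ F x * ∇ g⁺ x  ≡⟨ cong₂ _*_ (cong₂ _-_ (indicator-no C? ¬Ct) (indicator-yes C? Ch)) (entering x ¬Ct Ch) ⟩
          ℤ.-1ℤ * δ c₁ x  ≡⟨ tidy (δ c₁ x) ⟩
          - (δ c₁ x * 1ℤ + 0ℤ * 1ℤ) ≡⟨ cong (λ b → - (δ c₁ x * 1ℤ + b * 1ℤ)) (δ-≢ {i = rev c₁} {x} λ { refl → ¬Ct A₁.C-c }) ⟨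
          - (δ c₁ x * 1ℤ + δ (rev c₁) x * 1ℤ) ∎
          where
          tidy : ∀ a → ℤ.-1ℤ * a ≡ - (a * 1ℤ + 0ℤ * 1ℤ)
          tidy = solve-∀
        ... | yes Ct | no ¬Ch = begin
          ∇ F x * ∇ g⁺ x  ≡⟨ cong₂ _*_ (cong₂ _-_ (indicator-yes C? Ct) (indicator-no C? ¬Ch)) reversed ⟩
          1ℤ * - δ (rev c₁) x  ≡⟨ tidy (δ (rev c₁) x) ⟩
          - (0ℤ * 1ℤ + δ (rev c₁) x * 1ℤ) ≡⟨ cong (λ b → - (b * 1ℤ + δ (rev c₁) x * 1ℤ)) (δ-≢ {i = c₁} {x} λ { refl → A₁.outside-C Ct }) ⟨
          - (δ c₁ x * 1ℤ + δ (rev c₁) x * 1ℤ) ∎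
          where
          tidy : ∀ b → 1ℤ * - b ≡ - (0ℤ * 1ℤ + b * 1ℤ)
          tidy = solve-∀
          reversed : ∇ g⁺ x ≡ - δ (rev c₁) x
          reversed = begin
            ∇ g⁺ x               ≡⟨ ℤ.neg-involutive (∇ g⁺ x) ⟨
            - - ∇ g⁺ x           ≡⟨ cong -_ (∇-antisym g⁺ x) ⟨
            - ∇ g⁺ (rev x)       ≡⟨ cong -_ (entering (rev x) ¬Ch (subst C (sym (head-rev x)) Ct)) ⟩
            - δ c₁ (rev x)       ≡⟨ cong -_ (δ-rev c₁ x) ⟩
            - δ (rev c₁) x       ∎

        total : ∑ (λ x → ∇ F x * ∇ g⁺ x) ≡ ℤ.-[1+ 1 ]
        total = begin
          ∑ (λ x → ∇ F x * ∇ g⁺ x)                                ≡⟨ ∑-cong pointwise ⟩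
          ∑ (λ x → - (δ c₁ x * 1ℤ + δ (rev c₁) x * 1ℤ))           ≡⟨ ∑-neg _ ⟩
          - ∑ (λ x → δ c₁ x * 1ℤ + δ (rev c₁) x * 1ℤ)             ≡⟨ cong -_ (∑-+ (λ x → δ c₁ x * 1ℤ) (λ x → δ (rev c₁) x * 1ℤ)) ⟩
          - (∑ (λ x → δ c₁ x * 1ℤ) + ∑ (λ x → δ (rev c₁) x * 1ℤ)) ≡⟨ cong₂ (λ a b → - (a + b)) (∑-δ c₁ (λ _ → 1ℤ)) (∑-δ (rev c₁) (λ _ → 1ℤ)) ⟩
          ℤ.-[1+ 1 ]                                              ∎

  Apart-swap : ∀ {C D E} → Apart C D E → Apart D C E
  Apart-swap {C} {D} a = record
    { connected-C = connected-D ; connected-D = connected-C ; connected-E = connected-E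
    ; C-D = λ Dv Cv → C-D Cv Dv ; C-E = D-E ; D-E = C-E
    ; C-adj-D = λ x Dt Ch → C-adj-D (rev x) Ch (subst D (sym (head-rev x)) Dt) }
    where open Apart a

  Attachment-swap : ∀ {C D E} → Attachment C D E → Attachment D C E
  Attachment-swap {C} {D} {E} A = record
    { c = e ; e = c ; f = f ; tail-e = sym tail-e ; tail-f = trans tail-f (sym tail-e)
    ; C-c = D-e ; D-e = C-c ; E-f = E-f
    ; outside-C = subst (¬_ ∘ D) (sym tail-e) outside-D
    ; outside-D = subst (¬_ ∘ C) (sym tail-e) outside-C
    ; outside-E = subst (¬_ ∘ E) (sym tail-e) outside-E }
    where open Attachment A

  -- Exchanging `C` and `D` exchanges `c` and `e`, and with them the two sectors.
  negative-unique : ∀ {C D E} → Decidable D → Apart C D E → (A₁ A₂ : Attachment C D E) →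
    tail (Attachment.c A₁) ≢ tail (Attachment.c A₂) → Negative A₁ → ¬ Negative A₂
  negative-unique D? apart A₁ A₂ t₁≢t₂ turn₁ turn₂ =
    positive-unique D? (Apart-swap apart) (Attachment-swap A₁) (Attachment-swap A₂)
      (λ eq → t₁≢t₂ (trans (sym (Attachment.tail-e A₁)) (trans eq (Attachment.tail-e A₂)))) (Turn-swap turn₁) (Turn-swap turn₂)

  orientation : ∀ {C D E} (A : Attachment C D E) → Positive A ⊎ Negative A
  orientation A = turns c e f tail-f where open Attachment A

  -- Two of the three attachments have the same orientation.
  no-K₃₃ : ∀ {C D E} → Decidable C → Decidable D → Apart C D E → (A₁ A₂ A₃ : Attachment C D E) →
    let t = λ A → tail (Attachment.c {C} {D} {E} A) in t A₁ ≢ t A₂ → t A₁ ≢ t A₃ → t A₂ ≢ t A₃ → ⊥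
  no-K₃₃ {C} {D} {E} C? D? apart A₁ A₂ A₃ t₁≢t₂ t₁≢t₃ t₂≢t₃ with orientation A₁ | orientation A₂ | orientation A₃
  ... | inj₁ p | inj₁ q | _      = positive-unique C? apart A₁ A₂ t₁≢t₂ p q
  ... | inj₁ p | _      | inj₁ q = positive-unique C? apart A₁ A₃ t₁≢t₃ p q
  ... | _      | inj₁ p | inj₁ q = positive-unique C? apart A₂ A₃ t₂≢t₃ p q
  ... | inj₂ p | inj₂ q | _      = negative-unique D? apart A₁ A₂ t₁≢t₂ p q
  ... | inj₂ p | _      | inj₂ q = negative-unique D? apart A₁ A₃ t₁≢t₃ p q
  ... | _      | inj₂ p | inj₂ q = negative-unique D? apart A₂ A₃ t₂≢t₃ p q

-- Near triangulations are cleavable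

module Cuts {n} (M : Map n) where
  open Map M
  open MapReach M

  all-out⇒connected : ∀ {S} → (∀ u v → u ∉ₛ S → v ∉ₛ S → Out S u v) → Connected (∁ S)
  all-out⇒connected all u v u∈ v∈ = out⇒reach (all u v (Subset.x∈∁p⇒x∉p u∈) (Subset.x∈∁p⇒x∉p v∈))

  cut-witness : ∀ {S} → IsCut S → ∃ λ u → ∃ λ v → u ∉ₛ S × v ∉ₛ S × ¬ Out S u v
  cut-witness {S} cut with Fin.any? (λ u → Fin.any? (λ v → ¬? (u Subset.∈? S) ×-dec ¬? (v Subset.∈? S) ×-dec ¬? (out? S u v)))
  ... | yes found = found
  ... | no ¬found = contradiction (all-out⇒connected λ u v u∉ v∉ → joined u v u∉ v∉) cut
    where
    joined : ∀ u v → u ∉ₛ S → v ∉ₛ S → Out S u v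
    joined u v u∉ v∉ with out? S u v
    ... | yes uv = uv
    ... | no ¬uv = contradiction (u , v , u∉ , v∉ , ¬uv) ¬found

  not-out⇒cut : ∀ {S u v} → u ∉ₛ S → v ∉ₛ S → ¬ Out S u v → IsCut S
  not-out⇒cut u∉ v∉ ¬uv connected = ¬uv (reach⇒out (connected _ _ (Subset.x∉p⇒x∈∁p u∉) (Subset.x∉p⇒x∈∁p v∉)))

  not-cut⇒out : ∀ {S u v} → ¬ IsCut S → u ∉ₛ S → v ∉ₛ S → Out S u v
  not-cut⇒out {S} {u} {v} ¬cut u∉ v∉ with out? S u v
  ... | yes uv = uv
  ... | no ¬uv = contradiction (not-out⇒cut u∉ v∉ ¬uv) ¬cut

module NearTriangulation {n} (M : Map n) (spherical : Spherical M) (fourConnected : FourConnected M)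
  (one-large : Map.AtMostOneLargeFace M) where
  open Map M
  open MapProperties M
  open MapReach M
  open Cuts M
  open Plane M spherical fourConnected
  open Crossing M spherical fourConnected
  open Hodge M spherical

  private
    zero-of-multiple : ∀ k a → + suc k * a ≡ 0ℤ → a ≡ 0ℤ
    zero-of-multiple k a eq with ℤ.i*j≡0⇒i≡0∨j≡0 (+ suc k) eq
    ... | inj₂ a≡0 = a≡0

  ∑-antisym : ∀ {φ} → Antisymmetric φ → ∑ φ ≡ 0ℤ
  ∑-antisym {φ} anti = zero-of-multiple 1 (∑ φ) (begin
    + 2 * ∑ φ       ≡⟨ double (∑ φ) ⟩
    ∑ φ - - ∑ φ     ≡⟨ cong (_-_ (∑ φ)) (trans (sym (∑-neg φ)) (trans (∑-cong (λ x → sym (anti x))) (∑-rev φ))) ⟩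
    ∑ φ - ∑ φ       ≡⟨ ℤ.i≡j⇒i-j≡0 (refl {x = ∑ φ}) ⟩
    0ℤ              ∎)
    where
    double : ∀ a → + 2 * a ≡ a - - a
    double = solve-∀

  -- The value of g on the large face may be taken to be zero, and then the triangles contribute zero.
  closed-relative : ∀ {φ} → Antisymmetric φ → (∀ x → face (face (face x)) ≡ x → φ x + φ (face x) + φ (face (face x)) ≡ 0ℤ) →
    ∀ g → FaceInvariant g → ∀ κ → (∀ x → g x ≡ κ ⊎ face (face (face x)) ≡ x) → ∑ (λ x → φ x * g x) ≡ 0ℤ
  closed-relative {φ} anti triangle g inv κ cases = begin
    ∑ (λ x → φ x * g x)                       ≡⟨ ∑-cong (λ x → shift (φ x) (g x) κ) ⟩
    ∑ (λ x → φ x * h x + κ * φ x)             ≡⟨ ∑-+ _ _ ⟩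
    T + ∑ (λ x → κ * φ x)                     ≡⟨ cong₂ _+_ T≡0 (trans (∑-* κ φ) (trans (cong (κ *_) (∑-antisym anti)) (ℤ.*-zeroʳ κ))) ⟩
    0ℤ                                        ∎
    where
    h : Fin d → ℤ
    h x = g x - κ
    T : ℤ
    T = ∑ (λ x → φ x * h x)
    shift : ∀ a b k → a * b ≡ a * (b - k) + k * a
    shift = solve-∀
    rotate : ∀ (ψ : Fin d → ℤ) → ∑ (λ x → ψ (face x) * h x) ≡ ∑ (λ x → ψ x * h x)
    rotate ψ = trans (∑-cong (λ x → cong (λ e → ψ (face x) * (e - κ)) (sym (inv x)))) (∑-face (λ x → ψ x * h x))
    vanish : ∀ x → (φ x + φ (face x) + φ (face (face x))) * h x ≡ 0ℤ
    vanish x with cases x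
    ... | inj₁ g≡κ = trans (cong (λ e → (φ x + φ (face x) + φ (face (face x))) * e) (ℤ.i≡j⇒i-j≡0 g≡κ)) (ℤ.*-zeroʳ (φ x + φ (face x) + φ (face (face x))))
    ... | inj₂ tri = cong (_* h x) (triangle x tri)
    -- Reindexing along `face` shows that `φ`, `φ ∘ face` and `φ ∘ face ∘ face` have the same sum
    -- against `h`. In the sum of the three, each dart carries the total of `φ` over three
    -- consecutive darts of its face, which is zero on a triangle, and `h` is zero elsewhere.
    T≡0 : T ≡ 0ℤ
    T≡0 = zero-of-multiple 2 T (begin
      + 3 * T       ≡⟨ triple T ⟩
      T + T + T     ≡⟨ cong₂ (λ a b → T + a + b) (sym (rotate φ)) (sym (trans (rotate (φ ∘ face)) (rotate φ))) ⟩
      T + ∑ (λ x → φ (face x) * h x) + ∑ (λ x → φ (face (face x)) * h x)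
        ≡⟨ cong (_+ ∑ (λ x → φ (face (face x)) * h x)) (∑-+ (λ x → φ x * h x) (λ x → φ (face x) * h x)) ⟨
      ∑ (λ x → φ x * h x + φ (face x) * h x) + ∑ (λ x → φ (face (face x)) * h x)
        ≡⟨ ∑-+ (λ x → φ x * h x + φ (face x) * h x) (λ x → φ (face (face x)) * h x) ⟨
      ∑ (λ x → φ x * h x + φ (face x) * h x + φ (face (face x)) * h x)
        ≡⟨ ∑-zero (λ x → trans (collect (φ x) (φ (face x)) (φ (face (face x))) (h x)) (vanish x)) ⟩
      0ℤ ∎)
      where
      triple : ∀ a → + 3 * a ≡ a + a + a
      triple = solve-∀
      collect : ∀ a b c e → a * e + b * e + c * e ≡ (a + b + c) * e
      collect = solve-∀

  triangles⇒closed : ∀ {φ} → Antisymmetric φ →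
    (∀ x → face (face (face x)) ≡ x → φ x + φ (face x) + φ (face (face x)) ≡ 0ℤ) →
    ∀ g → FaceInvariant g → ∑ (λ x → φ x * g x) ≡ 0ℤ
  triangles⇒closed anti triangle g inv with Fin.any? (λ x → 4 ℕ.≤? faceLength x)
  ... | no none = closed-relative anti triangle g inv 0ℤ λ y → inj₂ (small⇒triangle y λ large → none (y , large))
  ... | yes (x , large) = closed-relative anti triangle g inv (g x) cases
    where
    cases : ∀ y → g y ≡ g x ⊎ face (face (face y)) ≡ y
    cases y with 4 ℕ.≤? faceLength y
    ... | yes large-y = inj₁ (sym (FaceInvariant-SameFace inv (one-large x y large large-y)))
    ... | no small = inj₂ (small⇒triangle y small)

  module _ {C A : Fin n → Set} (C? : Decidable C) (A? : Decidable A) (C-A : ∀ {v} → C v → ¬ A v)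
    (third : ∀ {u v w} → C u → A v → Adj u w → Adj v w → C w ⊎ A w) where

    private
      α β : Fin n → ℤ
      α = indicator C?
      β = indicator A?

      -- The signed number of steps from C to A: it is closed on triangles since, by third, every vertex of a
      -- triangle meeting both C and A is in C or A.
      K : Fin n → Fin n → ℤ
      K u v = α u * β v - β u * α v

      product-zero : ∀ u v → ¬ (C u × A v) → α u * β v ≡ 0ℤ
      product-zero u v ¬CA with C? u | A? v
      ... | yes Cu | yes Av = contradiction (Cu , Av) ¬CA
      ... | no ¬Cu | _      = cong (_* β v) (indicator-no C? ¬Cu)
      ... | yes _  | no ¬Av = trans (cong (α u *_) (indicator-no A? ¬Av)) (ℤ.*-zeroʳ (α u))

      K-zero : ∀ u v → ¬ (C u × A v) → ¬ (C v × A u) → K u v ≡ 0ℤ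
      K-zero u v ¬CA ¬AC = cong₂ _-_ (product-zero u v ¬CA) (trans (ℤ.*-comm (β u) (α v)) (product-zero v u ¬AC))

      β≡1-α : ∀ v → C v ⊎ A v → β v ≡ 1ℤ - α v
      β≡1-α v (inj₁ Cv) = trans (indicator-no A? (C-A Cv)) (cong (_-_ 1ℤ) (sym (indicator-yes C? Cv)))
      β≡1-α v (inj₂ Av) = trans (indicator-yes A? Av) (cong (_-_ 1ℤ) (sym (indicator-no C? λ Cv → C-A Cv Av)))

      K-opposite : ∀ u v w → ¬ (C w ⊎ A w) → Adj u w → Adj v w → K u v + K v w + K w u ≡ 0ℤ
      K-opposite u v w ¬w uw vw = cong₂ _+_ (cong₂ _+_
        (K-zero u v (λ (Cu , Av) → ¬w (third Cu Av uw vw)) (λ (Cv , Au) → ¬w (third Cv Au vw uw)))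
        (K-zero v w (λ (_ , Aw) → ¬w (inj₂ Aw)) (λ (Cw , _) → ¬w (inj₁ Cw))))
        (K-zero w u (λ (Cw , _) → ¬w (inj₁ Cw)) (λ (_ , Aw) → ¬w (inj₂ Aw)))

      rotate₃ : ∀ a b c → a + b + c ≡ b + c + a
      rotate₃ = solve-∀

      K-triangle : ∀ u v w → Adj u v → Adj v w → Adj w u → K u v + K v w + K w u ≡ 0ℤ
      K-triangle u v w uv vw wu with C? u ⊎-dec A? u | C? v ⊎-dec A? v | C? w ⊎-dec A? w
      ... | _ | _ | no ¬w = K-opposite u v w ¬w (Adj-sym wu) vw
      ... | no ¬u | _ | _ = trans (rotate₃ (K u v) (K v w) (K w u)) (K-opposite v w u ¬u (Adj-sym uv) wu)
      ... | _ | no ¬v | _ = trans (sym (rotate₃ (K w u) (K u v) (K v w))) (K-opposite w u v ¬v (Adj-sym vw) uv)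
      -- When all three vertices lie in `C` or `A`, `β` is `1ℤ - α` on them, so `K u v` reduces to
      -- `α u - α v` and the sum telescopes.
      ... | yes pu | yes pv | yes pw = begin
        α u * β v - β u * α v + (α v * β w - β v * α w) + (α w * β u - β w * α u)
          ≡⟨ K-cong (β≡1-α u pu) (β≡1-α v pv) (β≡1-α w pw) ⟩
        α u * (1ℤ - α v) - (1ℤ - α u) * α v + (α v * (1ℤ - α w) - (1ℤ - α v) * α w) + (α w * (1ℤ - α u) - (1ℤ - α w) * α u)
          ≡⟨ telescope (α u) (α v) (α w) ⟩
        0ℤ ∎
        where
        K-cong : ∀ {a b c a′ b′ c′} → a ≡ a′ → b ≡ b′ → c ≡ c′ →
          α u * b - a * α v + (α v * c - b * α w) + (α w * a - c * α u) ≡ α u * b′ - a′ * α v + (α v * c′ - b′ * α w) + (α w * a′ - c′ * α u)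
        K-cong refl refl refl = refl
        telescope : ∀ a b c → a * (1ℤ - b) - (1ℤ - a) * b + (b * (1ℤ - c) - (1ℤ - b) * c) + (c * (1ℤ - a) - (1ℤ - c) * a) ≡ 0ℤ
        telescope = solve-∀

      φ : Fin d → ℤ
      φ x = K (tail x) (head x)

      φ-antisym : Antisymmetric φ
      φ-antisym x = trans (cong (K (head x)) (head-rev x)) (swap (α (head x)) (β (tail x)) (β (head x)) (α (tail x)))
        where
        swap : ∀ a b c e → a * b - c * e ≡ - (e * c - b * a)
        swap = solve-∀

      φ-triangle : ∀ x → face (face (face x)) ≡ x → φ x + φ (face x) + φ (face (face x)) ≡ 0ℤ
      φ-triangle x tri = trans (cong₂ _+_ (cong₂ _+_ (cong (K (tail x)) (sym tx₁)) (cong (K (tail (face x))) (sym tx₂))) (cong (K (tail (face (face x)))) (sym tx₃)))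
        (K-triangle (tail x) (tail (face x)) (tail (face (face x))) (x , refl , sym tx₁) (face x , refl , sym tx₂) (face (face x) , refl , sym tx₃))
        where
        tx₁ = tail-face x
        tx₂ = tail-face (face x)
        tx₃ : tail x ≡ head (face (face x))
        tx₃ = trans (cong tail (sym tri)) (tail-face (face (face x)))

    component-potential : ∃ λ c → ∃ λ (f : Fin n → ℤ) → c ≢ 0ℤ ×
      (∀ {u v} → Adj u v → C u → A v → f v ≡ f u + c) ×
      (∀ {u v} → Adj u v → ¬ (C u × A v) → ¬ (C v × A u) → f u ≡ f v)
    component-potential = build (closed⇒exact connected v₀ x₀ φ-antisym (triangles⇒closed φ-antisym φ-triangle))
      where
      build : (∃ λ c → ∃ λ (f : Fin n → ℤ) → c ≢ 0ℤ × (∀ x → c * φ x ≡ f (head x) - f (tail x))) → _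
      build (c , f , c≢0 , eq) = c , f , c≢0 ,
        (λ { (x , refl , refl) Cu Av → trans (split (f (tail x)) (f (head x))) (cong (_+_ (f (tail x))) (trans (sym (eq x)) (trans (cong (c *_) (K-one Cu Av)) (ℤ.*-identityʳ c)))) }) ,
        (λ { (x , refl , refl) ¬CA ¬AC → sym (ℤ.i-j≡0⇒i≡j (f (head x)) (f (tail x)) (trans (sym (eq x)) (trans (cong (c *_) (K-zero _ _ ¬CA ¬AC)) (ℤ.*-zeroʳ c)))) })
        where
        split : ∀ a b → b ≡ a + (b - a)
        split = solve-∀
        K-one : ∀ {u v} → C u → A v → K u v ≡ 1ℤ
        K-one {u} {v} Cu Av = cong₂ _-_ (cong₂ _*_ (indicator-yes C? Cu) (indicator-yes A? Av)) (cong₂ _*_ (indicator-no A? (C-A Cu)) (indicator-no C? λ Cv → C-A Cv Av))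

  cleavable : Cleavable
  cleavable S (cut , minimal) a b a∈S b∈S with conn? S a b | cut-witness cut
  ... | yes ab | _ = conn⇒reach ab
  ... | no ¬ab | p , q , p∉S , q∉S , ¬pq = ⊥-elim (impossible (component-potential {C} {A} C? A? C-A third))
    where
    C A : Fin n → Set
    C = Out S p
    A = Conn Adj (_∈ₛ S) a

    C? : Decidable C
    C? = out? S p

    A? : Decidable A
    A? = conn? S a

    C-A : ∀ {v} → C v → ¬ A v
    C-A Cv Av = Conn-target Cv (Conn-target Av)

    third : ∀ {u v w} → C u → A v → Adj u w → Adj v w → C w ⊎ A w
    third {w = w} Cu Av uw vw with w Subset.∈? S
    ... | yes w∈ = inj₂ (Av ++ᶜ hop (Conn-target Av) vw (end w∈))
    ... | no w∉ = inj₁ (Cu ++ᶜ hop (Conn-target Cu) uw (end w∉))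

    rejoins : ∀ {s u v} → s ∈ₛ S → u ∉ₛ S → v ∉ₛ S → Out (S Subset.- s) u v
    rejoins {s} s∈S u∉ v∉ = not-cut⇒out (minimal (S Subset.- s) (Subset.x∈p⇒p-x⊂p s∈S)) (u∉ ∘ Subset.p─q⊆p S ⁅ s ⁆) (v∉ ∘ Subset.p─q⊆p S ⁅ s ⁆)

    touches-p : ∀ {s} → s ∈ₛ S → ∃ λ w → Adj s w × Out S p w
    touches-p s∈S = separator-adjacent p∉S ¬pq (rejoins s∈S p∉S q∉S)

    touches-q : ∀ {s} → s ∈ₛ S → ∃ λ w → Adj s w × Out S q w
    touches-q s∈S = separator-adjacent q∉S (¬pq ∘ out-sym) (rejoins s∈S q∉S p∉S)

    impossible : ¬ (∃ λ c → ∃ λ (f : Fin n → ℤ) → c ≢ 0ℤ ×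
      (∀ {u v} → Adj u v → C u → A v → f v ≡ f u + c) ×
      (∀ {u v} → Adj u v → ¬ (C u × A v) → ¬ (C v × A u) → f u ≡ f v))
    impossible (c , f , c≢0 , jump , level)
      with wa , a-wa , p-wa ← touches-p a∈S
      with wb , b-wb , p-wb ← touches-p b∈S
      with za , a-za , q-za ← touches-q a∈S
      with zb , b-zb , q-zb ← touches-q b∈S
      = c≢0 (cancel (f wa) c (begin
        -- This is the only step of the closed walk between `C` and `A`: the walk comes back into
        -- `C` through `b`, which lies outside `A`.
        f wa + c  ≡⟨ jump (Adj-sym a-wa) p-wa (end a∈S) ⟨
        f a       ≡⟨ level a-za (λ (Ca , _) → Conn-target Ca a∈S) (λ (Cz , _) → C-q Cz q-za) ⟩
        f za      ≡⟨ outside (out-sym q-za ++ᶜ q-zb) ⟩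
        f zb      ≡⟨ level b-zb (λ (Cb , _) → Conn-target Cb b∈S) (λ (Cz , _) → C-q Cz q-zb) ⟨
        f b       ≡⟨ level b-wb (λ (Cb , _) → Conn-target Cb b∈S) (λ (_ , Ab) → ¬ab Ab) ⟩
        f wb      ≡⟨ outside (out-sym p-wb ++ᶜ p-wa) ⟩
        f wa      ∎))
      where
      cancel : ∀ a c → a + c ≡ a → c ≡ 0ℤ
      cancel a c eq = trans (split a c) (ℤ.i≡j⇒i-j≡0 eq)
        where
        split : ∀ a c → c ≡ a + c - a
        split = solve-∀
      C-q : ∀ {z} → C z → ¬ Out S q z
      C-q pz qz = ¬pq (pz ++ᶜ out-sym qz)
      outside : ∀ {u v} → Out S u v → f u ≡ f v
      outside (end _) = refl
      outside (hop u∉ uw c) = trans (level uw (λ (_ , Aw) → Conn-source c (Conn-target Aw)) (λ (_ , Au) → u∉ (Conn-target Au))) (outside c)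

-- Cleavable graphs are near triangulations

least : ∀ {P : ℕ → Set} → Decidable P → ∀ k → P k → ∃ λ m → P m × (∀ j → j ℕ.< m → ¬ P j)
least {P} P? = <-rec _ search
  where
  search : ∀ k → (∀ {j} → j ℕ.< k → P j → ∃ λ m → P m × (∀ j → j ℕ.< m → ¬ P j)) → P k → ∃ λ m → P m × (∀ j → j ℕ.< m → ¬ P j)
  search k rec Pk with ℕ.anyUpTo? P? k
  ... | yes (j , j<k , Pj) = rec j<k Pj
  ... | no none = k , Pk , λ j j<k Pj → none (j , j<k , Pj)

-- Sorting

module _ {A : Set} (f : A → ℕ) where

  Increasing : List A → Set
  Increasing = AllPairs (λ a b → f a ℕ.< f b)

  insert : A → List A → List A
  insert a [] = a ∷ []
  insert a (b ∷ L) with f a ℕ.<? f b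
  ... | yes _ = a ∷ b ∷ L
  ... | no _  = b ∷ insert a L

  insert-length : ∀ a L → length (insert a L) ≡ suc (length L)
  insert-length a [] = refl
  insert-length a (b ∷ L) with f a ℕ.<? f b
  ... | yes _ = refl
  ... | no _  = cong suc (insert-length a L)

  insert-All : ∀ {P : A → Set} {a L} → P a → All P L → All P (insert a L)
  insert-All pa [] = pa ∷ []
  insert-All {a = a} {b ∷ L} pa (pb ∷ ps) with f a ℕ.<? f b
  ... | yes _ = pa ∷ pb ∷ ps
  ... | no _  = pb ∷ insert-All pa ps

  insert-increasing : ∀ {a L} → All (λ b → f a ≢ f b) L → Increasing L → Increasing (insert a L)
  insert-increasing [] [] = [] ∷ []
  insert-increasing {a} {b ∷ L} (a≢b ∷ a≢) (b< ∷ inc) with f a ℕ.<? f b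
  ... | yes a<b = (a<b ∷ All.map (ℕ.<-trans a<b) b<) ∷ b< ∷ inc
  ... | no a≮b = insert-All (ℕ.≤∧≢⇒< (ℕ.≮⇒≥ a≮b) (a≢b ∘ sym)) b< ∷ insert-increasing a≢ inc

-- The last component says that no new elements appear, in the form in which the induction uses it
-- for distinctness from `i`.
insertion-sort : ∀ {m} (f : Fin m → ℕ) → (∀ {i j} → f i ≡ f j → i ≡ j) → ∀ L → Unique L →
  ∃ λ L′ → length L′ ≡ length L × Increasing f L′ × (∀ {P : Fin m → Set} → All P L → All P L′)
insertion-sort f inj [] [] = [] , refl , [] , λ _ → []
insertion-sort f inj (i ∷ L) (i∉ ∷ u) with L′ , len , inc , keep ← insertion-sort f inj L u =
  insert f i L′ , trans (insert-length f i L′) (cong suc len) , insert-increasing f (keep (All.map (_∘ inj) i∉)) inc ,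
  λ { (p ∷ ps) → insert-All f p (keep ps) }

-- Serves to relabel the four disjoint walks by the positions of their ends along a face.
sorted-enumeration : ∀ {m} (f : Fin m → ℕ) → (∀ {i j} → f i ≡ f j → i ≡ j) → ∃ λ L → length L ≡ m × Increasing f L
sorted-enumeration {m} f inj with L , len , inc , _ ← insertion-sort f inj (allFin m) (Unique.allFin⁺ m) =
  L , trans len (length-tabulate id) , inc

module _ {n} {P : Fin n → Set} (P? : Decidable P) where

  subset : Subset n
  subset = tabulateᵥ (λ v → does (P? v))

  ∈-subset⁺ : ∀ {v} → P v → v ∈ₛ subset
  ∈-subset⁺ {v} p = lookup⇒[]= v subset (trans (lookup∘tabulate _ v) holds)
    where
    holds : does (P? v) ≡ true
    holds with P? v
    ... | yes _ = refl
    ... | no ¬p = contradiction p ¬p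

  ∈-subset⁻ : ∀ {v} → v ∈ₛ subset → P v
  ∈-subset⁻ {v} v∈ with P? v | trans (sym (lookup∘tabulate (λ v → does (P? v)) v)) ([]=⇒lookup v∈)
  ... | yes p | _ = p
  ... | no _  | ()

suffix : ∀ {V : Set} {R : V → V → Set} {Y : V → Set} {u w} (p : Walk R Y u) → On p w → Conn R (On p) w (target p)
suffix (stop _)     refl        = end refl
suffix (step ¬y r p) (inj₁ refl) = walk⇒conn (step ¬y r p)
suffix (step _ _ p) (inj₂ on)   = Conn-map id inj₂ (suffix p on)

on? : ∀ {n} {R : Fin n → Fin n → Set} {Y : Fin n → Set} {u} (p : Walk R Y u) → Decidable (On p)
on? (stop {u} _)     w = w Fin.≟ u
on? (step {u} _ _ p) w = (w Fin.≟ u) ⊎-dec on? p w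

-- Minimal separators of two vertices are minimal cuts

module MinimalSeparators {n} (M : Map n) (spherical : Spherical M) (fourConnected : FourConnected M) where
  open Map M
  open MapProperties M
  open MapReach M
  open Cuts M
  open Plane M spherical fourConnected
  open Crossing M spherical fourConnected

  Separates : Subset n → Fin n → Fin n → Set
  Separates S u v = ¬ Out S u v × (∀ s → s ∈ₛ S → Out (S Subset.- s) u v)

  -- Vertices whose removal leaves `u` and `v` separated are deleted one at a time.
  minimal-separator : ∀ {u v} S → ¬ Out S u v → ∃ λ T → T Subset.⊆ S × Separates T u v
  minimal-separator {u} {v} S = go (suc ∣ S ∣) S ℕ.≤-refl
    where
    go : ∀ k S → ∣ S ∣ ℕ.< k → ¬ Out S u v → ∃ λ T → T Subset.⊆ S × Separates T u v
    go (suc k) S (s≤s |S|≤k) ¬uv with Fin.any? (λ s → (s Subset.∈? S) ×-dec ¬? (out? (S Subset.- s) u v))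
    ... | no none = S , id , ¬uv , λ s s∈ → case out? (S Subset.- s) u v of λ where
      (yes uv) → uv
      (no ¬uv′) → contradiction (s , s∈ , ¬uv′) none
    ... | yes (s , s∈ , ¬uv′)
      with T , T⊆ , sep ← go k (S Subset.- s) (ℕ.<-≤-trans (Subset.x∈p⇒∣p-x∣<∣p∣ s∈) |S|≤k) ¬uv′
      = T , (λ t∈ → Subset.p─q⊆p S ⁅ s ⁆ (T⊆ t∈)) , sep

  within : ∀ {S : Subset n} {p u v} → Out S p u → Out S u v → Conn Adj (Out S p) u v
  within pu (end _)      = end pu
  within pu (hop _ a uv) = hop pu a (within (pu ++ᶜ hop (Conn-target pu) a (end (Conn-source uv))) uv)

  -- A minimal separator of p and q leaves only two components, since a third one would be attached to three
  -- of its vertices, each of them adjacent to the components of p and q.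
  module _ {S : Subset n} {p q : Fin n} (p∉S : p ∉ₛ S) (q∉S : q ∉ₛ S) (separates : Separates S p q) where

    private
      ¬pq : ¬ Out S p q
      ¬pq = proj₁ separates

      touches-p : ∀ {s} → s ∈ₛ S → ∃ λ w → Adj s w × Out S p w
      touches-p s∈S = separator-adjacent p∉S ¬pq (proj₂ separates _ s∈S)

      touches-q : ∀ {s} → s ∈ₛ S → ∃ λ w → Adj s w × Out S q w
      touches-q s∈S = separator-adjacent q∉S (¬pq ∘ out-sym) (out-sym (proj₂ separates _ s∈S))

      Attached : Fin n → Fin n → Set
      Attached u t = t ∈ₛ S × ∃ λ w → Adj t w × Out S u w

      -- Deleting at most three vertices leaves a walk from `u` to `p`, and the first vertex of `S`
      -- on it is attached to the component of `u`.
      another : ∀ {u} → u ∉ₛ S → ¬ Out S p u → ∀ L → length L ℕ.< 4 → (∀ {t} → t ∈ L → t ∈ₛ S) → ∃ λ t → t ∉ L × Attached u t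
      another {u} u∉S ¬pu L lt L⊆S = go (end u∉S) (outside-list L lt (u∉S ∘ L⊆S) (p∉S ∘ L⊆S))
        where
        go : ∀ {w} → Out S u w → Conn Adj (_∉ L) w p → ∃ λ t → t ∉ L × Attached u t
        go uw (end _) = contradiction (out-sym uw) ¬pu
        go uw (hop {w = w} _ a c) with w Subset.∈? S
        ... | yes w∈S = w , Conn-source c , w∈S , _ , Adj-sym a , uw
        ... | no w∉S = go (uw ++ᶜ hop (Conn-target uw) a (end w∉S)) c

    no-third-component : ∀ {u} → u ∉ₛ S → ¬ Out S p u → ¬ Out S q u → ⊥
    no-third-component {u} u∉S ¬pu ¬qu
      with t₁ , _ , at₁ ← another u∉S ¬pu [] (s≤s z≤n) (λ ())
      with t₂ , t₂∉ , at₂ ← another u∉S ¬pu (t₁ ∷ []) (s≤s (s≤s z≤n)) (λ { (here refl) → proj₁ at₁ })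
      with t₃ , t₃∉ , at₃ ← another u∉S ¬pu (t₁ ∷ t₂ ∷ []) (s≤s (s≤s (s≤s z≤n))) (λ { (here refl) → proj₁ at₁ ; (there (here refl)) → proj₁ at₂ })
      = no-K₃₃ (out? S p) (out? S q) apart (attach at₁) (attach at₂) (attach at₃)
          (apart-tails at₁ at₂ λ { refl → t₂∉ (here refl) })
          (apart-tails at₁ at₃ λ { refl → t₃∉ (here refl) })
          (apart-tails at₂ at₃ λ { refl → t₃∉ (there (here refl)) })
      where
      apart : Apart (Out S p) (Out S q) (Out S u)
      apart = record
        { connected-C = λ pv pw → within pv (out-sym pv ++ᶜ pw)
        ; connected-D = λ qv qw → within qv (out-sym qv ++ᶜ qw)
        ; connected-E = λ uv uw → within uv (out-sym uv ++ᶜ uw)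
        ; C-D = λ pv qv → ¬pq (pv ++ᶜ out-sym qv)
        ; C-E = λ pv uv → ¬pu (pv ++ᶜ out-sym uv)
        ; D-E = λ qv uv → ¬qu (qv ++ᶜ out-sym uv)
        ; C-adj-D = λ x pt qh → ¬pq (pt ++ᶜ hop (Conn-target pt) (x , refl , refl) (out-sym qh)) }

      attach : ∀ {t} → Attached u t → Attachment (Out S p) (Out S q) (Out S u)
      attach {t} (t∈S , _ , (f , tf , refl) , uw)
        with _ , (c , tc , refl) , pw ← touches-p t∈S
        with _ , (e , te , refl) , qw ← touches-q t∈S
        = record
        { c = c ; e = e ; f = f ; tail-e = trans te (sym tc) ; tail-f = trans tf (sym tc)
        ; C-c = pw ; D-e = qw ; E-f = uw
        ; outside-C = λ pt → Conn-target pt (subst (_∈ₛ S) (sym tc) t∈S)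
        ; outside-D = λ qt → Conn-target qt (subst (_∈ₛ S) (sym tc) t∈S)
        ; outside-E = λ ut → Conn-target ut (subst (_∈ₛ S) (sym tc) t∈S) }

      attach-tail : ∀ {t} (at : Attached u t) → tail (Attachment.c (attach at)) ≡ t
      attach-tail {t} (t∈S , _ , (f , tf , refl) , uw)
        with _ , (c , tc , refl) , pw ← touches-p t∈S
        with _ , (e , te , refl) , qw ← touches-q t∈S
        = tc

      apart-tails : ∀ {t t′} (at : Attached u t) (at′ : Attached u t′) → t ≢ t′ →
        tail (Attachment.c (attach at)) ≢ tail (Attachment.c (attach at′))
      apart-tails at at′ t≢t′ eq = t≢t′ (trans (sym (attach-tail at)) (trans eq (attach-tail at′)))

    -- A proper subset misses some `s` in `S`, through which `p` and `q` are joined. Every other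
    -- vertex of `S` left out is adjacent to the component of `p`, and the rest lies in the
    -- component of `p` or of `q`, as there is no third.
    separator⇒minimal-cut : IsMinimalCut S
    separator⇒minimal-cut = not-out⇒cut p∉S q∉S ¬pq , λ T (T⊆S , s , s∈S , s∉T) cut → refute T T⊆S s∈S s∉T (cut-witness cut)
      where
      refute : ∀ T → T Subset.⊆ S → ∀ {s} → s ∈ₛ S → s ∉ₛ T → ¬ (∃ λ u → ∃ λ v → u ∉ₛ T × v ∉ₛ T × ¬ Out T u v)
      refute T T⊆S {s} s∈S s∉T (u , v , u∉T , v∉T , ¬uv) = ¬uv (out-sym (p-reaches u∉T) ++ᶜ p-reaches v∉T)
        where
        via : ∀ {t} → t ∈ₛ S → t ∉ₛ T → Out T p t
        via t∈S t∉T with w , a , pw ← touches-p t∈S = out-mono T⊆S pw ++ᶜ hop (Conn-target pw ∘ T⊆S) (Adj-sym a) (end t∉T)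

        pq : Out T p q
        pq with w , a , qw ← touches-q s∈S = via s∈S s∉T ++ᶜ hop s∉T a (out-mono T⊆S (out-sym qw))

        p-reaches : ∀ {u} → u ∉ₛ T → Out T p u
        p-reaches {u} u∉T with u Subset.∈? S
        ... | yes u∈S = via u∈S u∉T
        ... | no u∉S with out? S p u | out? S q u
        ...   | yes pu | _ = out-mono T⊆S pu
        ...   | no _ | yes qu = pq ++ᶜ out-mono T⊆S qu
        ...   | no ¬pu | no ¬qu = ⊥-elim (no-third-component u∉S ¬pu ¬qu)

-- Four disjoint walks between two large faces

module TwoLargeFaces {n} (M : Map n) (spherical : Spherical M) (fourConnected : FourConnected M) where
  open Map M
  open MapProperties M
  open MapReach M
  open Cuts M
  open Plane M spherical fourConnected
  open Crossing M spherical fourConnected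
  open MinimalSeparators M spherical fourConnected
  open Menger {n}

  OnFace : Fin d → Fin n → Set
  OnFace x v = ∃ λ y → tail y ≡ v × SameFace x y

  OnFace? : ∀ x → Decidable (OnFace x)
  OnFace? x v = Fin.any? (λ y → (tail y Fin.≟ v) ×-dec SameFace? x y)

  -- By `tail-injective` a face has as many vertices as darts, so three vertices cannot cover a
  -- large one.
  large⇒fresh : ∀ {x} → LargeFace x → ∀ S → length S ℕ.< 4 → ∃ λ v → OnFace x v × v ∉ S
  large⇒fresh {x} large S lt with Fin.any? (λ v → OnFace? x v ×-dec ¬? (any? (v Fin.≟_) S))
  ... | yes found = found
  ... | no none = contradiction
      (injection-length S (λ i → tail (at i)) listed (λ {i} {j} eq → count-lookup-injective (SameFace? x)
        (tail-injective (SameFace-trans (SameFace-sym (on i)) (on j)) eq)))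
      (ℕ.<⇒≱ (ℕ.<-≤-trans lt large))
    where
    at : Fin (faceLength x) → Fin d
    at = count-lookup (SameFace? x)
    on : ∀ i → SameFace x (at i)
    on = count-lookup-holds (SameFace? x)
    listed : ∀ i → tail (at i) ∈ S
    listed i with any? (tail (at i) Fin.≟_) S
    ... | yes ∈S = ∈S
    ... | no ∉S = contradiction (tail (at i) , (at i , refl , on i) , ∉S) none

  edges : List (Fin n × Fin n)
  edges = map (λ x → tail x , head x) (allFin d)

  edge⇒adj : ∀ {u v} → Edge edges u v → Adj u v
  edge⇒adj (inj₁ e) with x , _ , refl ← ∈-map⁻ (λ x → tail x , head x) e = x , refl , refl
  edge⇒adj (inj₂ e) with x , _ , refl ← ∈-map⁻ (λ x → tail x , head x) e = rev x , refl , head-rev x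

  adj⇒edge : ∀ {u v} → Adj u v → Edge edges u v
  adj⇒edge (x , refl , refl) = inj₁ (∈-map⁺ (λ x → tail x , head x) (∈-allFin x))

  -- Fewer than four vertices neither cover one of the two faces nor disconnect the graph, which is
  -- the hypothesis of Menger's theorem.
  linkage : ∀ {x y} → LargeFace x → LargeFace y → ¬ ¬ Linkage (Edge edges) 4 (OnFace y) (OnFace x)
  linkage {x} {y} large-x large-y = menger edges 4 (OnFace? x) joins
    where
    joins : ∀ S → length S ℕ.< 4 → ¬ ¬ Joined (Edge edges) S (OnFace y) (OnFace x)
    joins S lt ¬joined
      with v , v-on , v∉ ← large⇒fresh large-x S lt
      with u , u-on , u∉ ← large⇒fresh large-y S lt
      = ¬joined (v , v-on , u , u-on , Conn-map adj⇒edge id (outside-list S lt u∉ v∉))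

  module _ (x₁ x₂ : Fin d) (x₁≁x₂ : ¬ SameFace x₁ x₂) (L : Linkage (Edge edges) 4 (OnFace x₂) (OnFace x₁)) where
    open Linkage L

    private
      at : ℕ → Fin d
      at m = iter face m x₁

      p : ℕ → Fin n
      p m = tail (at m)

      period : ∃ λ ℓ → at (suc ℓ) ≡ x₁ × (∀ j → j ℕ.< ℓ → at (suc j) ≢ x₁)
      period with k , _ , return ← iter-return face face-injective x₁ = least (λ m → at (suc m) Fin.≟ x₁) k return

      ℓ : ℕ
      ℓ = suc (proj₁ period)

      return : at ℓ ≡ x₁
      return = proj₁ (proj₂ period)

      -- Positions on the face are natural numbers rather than residues modulo `ℓ`, so an arc
      -- passing the base dart is still an interval; vertices are distinct within any window of
      -- length `ℓ`.
      p-injective : ∀ {i j} → i ℕ.< j → j ℕ.< i ℕ.+ ℓ → p i ≢ p j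
      p-injective {i} {j} i<j j<i+ℓ eq with j ℕ.∸ i in gap
        | iter-cancel face face-injective x₁ (ℕ.<⇒≤ i<j) (tail-injective (SameFace-trans (SameFace-sym (sameFace i refl)) (sameFace j refl)) eq)
      ... | zero  | _ = ℕ.<⇒≱ i<j (ℕ.m∸n≡0⇒m≤n gap)
      ... | suc m | back = proj₂ (proj₂ period) m (ℕ.≤-pred m<ℓ) back
        where
        m<ℓ : suc m ℕ.< ℓ
        m<ℓ = subst (ℕ._< ℓ) gap (ℕ.+-cancelˡ-< i (j ℕ.∸ i) ℓ (subst (ℕ._< i ℕ.+ ℓ) (sym (ℕ.m+[n∸m]≡n (ℕ.<⇒≤ i<j))) j<i+ℓ))

      p-injective′ : ∀ {i j} → i ℕ.< ℓ → j ℕ.< ℓ → p i ≡ p j → i ≡ j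
      p-injective′ {i} {j} i<ℓ j<ℓ eq with ℕ.<-cmp i j
      ... | tri< i<j _ _ = contradiction eq (p-injective i<j (ℕ.<-≤-trans j<ℓ (ℕ.m≤n+m ℓ i)))
      ... | tri≈ _ i≡j _ = i≡j
      ... | tri> _ _ j<i = contradiction (sym eq) (p-injective j<i (ℕ.<-≤-trans i<ℓ (ℕ.m≤n+m ℓ j)))

      on-face : ∀ m → OnFace x₁ (p m)
      on-face m = at m , refl , sameFace m refl

      arc⁺ : ∀ {Q : Fin n → Set} i k → (∀ m → i ℕ.≤ m → m ℕ.≤ k ℕ.+ i → Q (p m)) → Conn Adj Q (p i) (p (k ℕ.+ i))
      arc⁺ i zero    Qs = end (Qs i ℕ.≤-refl ℕ.≤-refl)
      arc⁺ i (suc k) Qs = arc⁺ i k (λ m i≤m m≤ → Qs m i≤m (ℕ.m≤n⇒m≤1+n m≤))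
        ++ᶜ hop (Qs (k ℕ.+ i) (ℕ.m≤n+m i k) (ℕ.n≤1+n _)) (at (k ℕ.+ i) , refl , sym (tail-face _)) (end (Qs _ (ℕ.m≤n+m i (suc k)) ℕ.≤-refl))

      face-arc : ∀ {Q : Fin n → Set} {i j} → i ℕ.≤ j → (∀ m → i ℕ.≤ m → m ℕ.≤ j → Q (p m)) → Conn Adj Q (p i) (p j)
      face-arc {Q} {i} {j} i≤j Qs = subst (λ e → Conn Adj Q (p i) (p e)) (ℕ.m∸n+n≡m i≤j)
        (arc⁺ i (j ℕ.∸ i) (λ m i≤m m≤ → Qs m i≤m (ℕ.≤-trans m≤ (ℕ.≤-reflexive (ℕ.m∸n+n≡m i≤j)))))

      P : Fin 4 → Fin n → Set
      P i = On (walk i)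

      T : Fin 4 → Fin n
      T i = target (walk i)

      place : ∀ i → ∃ λ m → m ℕ.< ℓ × p m ≡ T i
      place i with y , ty , (k , refl) ← target-holds (walk i) with m , m≤ , eq ← iter-reduce face face-injective return (toℕ k) =
        m , s≤s m≤ , trans (cong tail eq) ty

      pos : Fin 4 → ℕ
      pos i = proj₁ (place i)

      pos<ℓ : ∀ i → pos i ℕ.< ℓ
      pos<ℓ i = proj₁ (proj₂ (place i))

      p-pos : ∀ i → p (pos i) ≡ T i
      p-pos i = proj₂ (proj₂ (place i))

      pos-injective : ∀ {i j} → pos i ≡ pos j → i ≡ j
      pos-injective {i} {j} eq = disjoint (target-on (walk i)) (subst (P j) (trans (sym (p-pos j)) (trans (cong p (sym eq)) (p-pos i))) (target-on (walk j)))

      on-arc : ∀ i m → P i (p m) → p m ≡ p (pos i)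
      on-arc i m on = trans (on-target (walk i) on (on-face m)) (sym (p-pos i))

      on-window : ∀ i {m} → m ℕ.< ℓ → P i (p m) → m ≡ pos i
      on-window i {m} m<ℓ on = p-injective′ m<ℓ (pos<ℓ i) (on-arc i m on)

      linked : ∀ i → Conn Adj (P i) (T i) (source i)
      linked i = Conn-sym Adj-sym (Conn-map edge⇒adj id (walk⇒conn (walk i)))

      -- Such a walk, closed up by the face arc through `T b`, would violate `cross`: `P e` carries
      -- the value of the face of `x₁` to the face of `x₂`, while `P b`, leaving `T b` on the other
      -- side of the curve, carries a different value there.
      separated : ∀ a b c e → pos a ℕ.< pos b → pos b ℕ.< pos c → pos e ℕ.< pos a ⊎ pos c ℕ.< pos e →
        ¬ Conn Adj (λ w → ¬ P b w × ¬ P e w) (T a) (T c)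
      separated a b c e a<b b<c out ac with pos b in pos-b
      -- A position above `pos a` is positive, so the arc reaches `T b` along the preceding dart
      -- `at k`, which is `face⁻¹ y`.
      ... | suc k = cross {Q} y ¬Qy curve y~y′ z~z′ y≁z through aside
        where
        Q : Fin n → Set
        Q w = ¬ P b w × ¬ P e w

        y : Fin d
        y = at (suc k)

        tail-y : tail y ≡ T b
        tail-y = trans (cong p (sym pos-b)) (p-pos b)

        ¬Qy : ¬ Q (tail y)
        ¬Qy (¬b , _) = ¬b (subst (P b) (sym tail-y) (target-on (walk b)))

        Qs : ∀ m → pos a ℕ.≤ m → m ℕ.≤ pos c → m ≢ suc k → Q (p m)
        Qs m a≤m m≤c m≢b = (λ on → m≢b (trans (on-window b m<ℓ on) pos-b)) , λ on → out-of-range (on-window e m<ℓ on) out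
          where
          m<ℓ = ℕ.≤-<-trans m≤c (pos<ℓ c)
          out-of-range : m ≡ pos e → pos e ℕ.< pos a ⊎ pos c ℕ.< pos e → ⊥
          out-of-range refl (inj₁ e<a) = ℕ.<⇒≱ e<a a≤m
          out-of-range refl (inj₂ c<e) = ℕ.<⇒≱ c<e m≤c

        curve : Conn Adj Q (head y) (tail (face⁻¹ y))
        curve = subst₂ (Conn Adj Q) (tail-face y) (cong tail (sym (face⁻¹-face (at k))))
          (face-arc b<c (λ m b<m m≤c → Qs m (ℕ.≤-trans (ℕ.<⇒≤ a<b) (ℕ.<⇒≤ b<m)) m≤c (ℕ.<⇒≢ b<m ∘ sym))
          ++ᶜ subst₂ (Conn Adj Q) (sym (p-pos c)) (sym (p-pos a)) (Conn-sym Adj-sym ac)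
          ++ᶜ face-arc (ℕ.≤-pred a<b) (λ m a≤m m≤k → Qs m a≤m (ℕ.≤-trans m≤k (ℕ.≤-trans (ℕ.n≤1+n k) (ℕ.<⇒≤ b<c))) (ℕ.<⇒≢ (s≤s m≤k))))

        y′ = at (pos e)
        z  = proj₁ (source-X b)
        z′ = proj₁ (source-X e)

        y~y′ : SameFace y y′
        y~y′ = SameFace-trans (SameFace-sym (sameFace (suc k) refl)) (sameFace (pos e) refl)

        z~z′ : SameFace z z′
        z~z′ = SameFace-trans (SameFace-sym (proj₂ (proj₂ (source-X b)))) (proj₂ (proj₂ (source-X e)))

        y≁z : ¬ SameFace y z
        y≁z y~z = x₁≁x₂ (SameFace-trans (sameFace (suc k) refl) (SameFace-trans y~z (SameFace-sym (proj₂ (proj₂ (source-X b))))))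

        through : Conn Adj (λ w → ¬ Q w) (tail y) (tail z)
        through = subst₂ (Conn Adj (λ w → ¬ Q w)) (sym tail-y) (sym (proj₁ (proj₂ (source-X b)))) (Conn-map id (λ on (¬b , _) → ¬b on) (linked b))

        b≢e : b ≢ e
        b≢e b≡e = clash out
          where
          clash : pos e ℕ.< pos a ⊎ pos c ℕ.< pos e → ⊥
          clash (inj₁ e<a) = ℕ.<-asym (subst (ℕ._< pos a) (trans (cong pos (sym b≡e)) pos-b) e<a) a<b
          clash (inj₂ c<e) = ℕ.<-asym (subst (pos c ℕ.<_) (trans (cong pos (sym b≡e)) pos-b) c<e) b<c

        aside : Conn Adj (λ w → ¬ Q w × w ≢ tail y) (tail y′) (tail z′)
        aside = subst₂ (Conn Adj (λ w → ¬ Q w × w ≢ tail y)) (sym (p-pos e)) (sym (proj₁ (proj₂ (source-X e))))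
          (Conn-map id (λ on → (λ (_ , ¬e) → ¬e on) , λ { refl → b≢e (disjoint (target-on (walk b)) (subst (P e) tail-y on)) }) (linked e))

      impossible : Cleavable → ∀ i₀ i₁ i₂ i₃ → pos i₀ ℕ.< pos i₁ → pos i₁ ℕ.< pos i₂ → pos i₂ ℕ.< pos i₃ → ⊥
      impossible cleavable i₀ i₁ i₂ i₃ 0<1 1<2 2<3 = refute (minimal-separator S₀ ¬02)
        where
        0<2 = ℕ.<-trans 0<1 1<2
        1<3 = ℕ.<-trans 1<2 2<3

        ≢-pos : ∀ {i j} → pos i ℕ.< pos j → i ≢ j
        ≢-pos lt refl = ℕ.<-irrefl refl lt

        S₀? : Decidable (λ v → P i₁ v ⊎ P i₃ v)
        S₀? v = on? (walk i₁) v ⊎-dec on? (walk i₃) v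

        S₀ : Subset n
        S₀ = subset S₀?

        ¬02 : ¬ Out S₀ (T i₀) (T i₂)
        ¬02 c = separated i₀ i₁ i₂ i₃ 0<1 1<2 (inj₂ 2<3)
          (Conn-map id (λ w∉ → (λ on → w∉ (∈-subset⁺ S₀? (inj₁ on))) , (λ on → w∉ (∈-subset⁺ S₀? (inj₂ on)))) c)

        -- An edge would complete the final parts of `P i₁` and `P i₃` to a walk from `T i₁` to
        -- `T i₃` that misses the other two walks. This is excluded by `separated` with the cyclic
        -- order shifted by one.
        no-edge : ∀ {u v} → P i₁ u → P i₃ v → ¬ Adj u v
        no-edge {u} {v} on-u on-v uv = separated i₁ i₂ i₃ i₀ 1<2 2<3 (inj₁ 0<1)
          (Conn-sym Adj-sym (Conn-map edge⇒adj off₁ (suffix (walk i₁) on-u)) ++ᶜ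
           hop (off₁ on-u) uv (Conn-map edge⇒adj off₃ (suffix (walk i₃) on-v)))
          where
          off₁ : ∀ {w} → P i₁ w → ¬ P i₂ w × ¬ P i₀ w
          off₁ on = (λ on₂ → ≢-pos 1<2 (disjoint on on₂)) , (λ on₀ → ≢-pos 0<1 (disjoint on₀ on))
          off₃ : ∀ {w} → P i₃ w → ¬ P i₂ w × ¬ P i₀ w
          off₃ on = (λ on₂ → ≢-pos 2<3 (disjoint on₂ on)) , (λ on₀ → ≢-pos (ℕ.<-trans 0<2 2<3) (disjoint on₀ on))

        T∉S₀ : ∀ i → i ≢ i₁ → i ≢ i₃ → T i ∉ₛ S₀
        T∉S₀ i i≢i₁ i≢i₃ T∈ with ∈-subset⁻ S₀? T∈
        ... | inj₁ on = i≢i₁ (disjoint (target-on (walk i)) on)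
        ... | inj₂ on = i≢i₃ (disjoint (target-on (walk i)) on)

        refute : ¬ (∃ λ S → S Subset.⊆ S₀ × Separates S (T i₀) (T i₂))
        refute (S , S⊆S₀ , separates) = stranded (proj₁ meets₁) (proj₁ meets₃)
          (reach⇒conn (cleavable S (separator⇒minimal-cut (T∉S₀ i₀ (≢-pos 0<1) (≢-pos (ℕ.<-trans 0<2 2<3)) ∘ S⊆S₀) (T∉S₀ i₂ (≢-pos 1<2 ∘ sym) (≢-pos 2<3) ∘ S⊆S₀) separates)
            _ _ (proj₁ (proj₂ meets₁)) (proj₁ (proj₂ meets₃)))) (proj₂ (proj₂ meets₁)) (proj₂ (proj₂ meets₃))
          where
          cases : ∀ {w} → w ∈ₛ S → P i₁ w ⊎ P i₃ w
          cases w∈ = ∈-subset⁻ S₀? (S⊆S₀ w∈)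

          meets₃ : ∃ λ w → w ∈ₛ S × P i₃ w
          meets₃ with Fin.any? (λ w → (w Subset.∈? S) ×-dec on? (walk i₃) w)
          ... | yes found = found
          ... | no none = contradiction around (proj₁ separates)
            where
            around : Out S (T i₀) (T i₂)
            -- The face arc from `T i₂` past the base dart to `T i₀`, now at position `pos i₀` plus
            -- `ℓ`. It stays strictly between `pos i₁` and `pos i₁` plus `ℓ`, so it misses `P i₁`.
            around = out-sym (subst₂ (Out S) (p-pos i₂) (trans (cong tail (trans (iter-+ face (pos i₀) ℓ x₁) (cong (iter face (pos i₀)) return))) (p-pos i₀))
              (face-arc (ℕ.≤-trans (ℕ.<⇒≤ (pos<ℓ i₂)) (ℕ.m≤n+m ℓ (pos i₀))) λ m 2≤m m≤ m∈S → case cases m∈S of λ where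
                (inj₂ on) → none (p m , m∈S , on)
                (inj₁ on) → p-injective (ℕ.<-≤-trans 1<2 2≤m) (ℕ.≤-<-trans m≤ (ℕ.+-monoˡ-< ℓ 0<1)) (sym (on-arc i₁ m on))))

          meets₁ : ∃ λ w → w ∈ₛ S × P i₁ w
          meets₁ with Fin.any? (λ w → (w Subset.∈? S) ×-dec on? (walk i₁) w)
          ... | yes found = found
          ... | no none = contradiction straight (proj₁ separates)
            where
            straight : Out S (T i₀) (T i₂)
            straight = subst₂ (Out S) (p-pos i₀) (p-pos i₂)
              (face-arc (ℕ.<⇒≤ 0<2) λ m _ m≤2 m∈S → case cases m∈S of λ where
                (inj₁ on) → none (p m , m∈S , on)
                (inj₂ on) → ℕ.<⇒≢ (ℕ.≤-<-trans m≤2 2<3) (on-window i₃ (ℕ.≤-<-trans m≤2 (pos<ℓ i₂)) on))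

          -- A walk inside `S` from `P i₁` to `P i₃` would have to pass from one to the other along
          -- an edge.
          stranded : ∀ u v → Conn Adj (_∈ₛ S) u v → P i₁ u → P i₃ v → ⊥
          stranded u _ (end _) on₁ on₃ = ≢-pos 1<3 (disjoint on₁ on₃)
          stranded u v (hop {w = w} _ a c) on₁ on₃ with cases (Conn-source c)
          ... | inj₁ on = stranded w v c on on₃
          ... | inj₂ on = no-edge on₁ on a

    linkage⇒not-cleavable : ¬ Cleavable
    linkage⇒not-cleavable cleavable with sorted-enumeration pos pos-injective
    ... | i₀ ∷ i₁ ∷ i₂ ∷ i₃ ∷ [] , refl , ((0<1 ∷ _) ∷ (1<2 ∷ _) ∷ (2<3 ∷ _) ∷ _) = impossible cleavable i₀ i₁ i₂ i₃ 0<1 1<2 2<3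

  at-most-one-large-face : Cleavable → AtMostOneLargeFace
  at-most-one-large-face cleavable x y large-x large-y with SameFace? x y
  ... | yes same = same
  -- The goal has become absurdity, so a linkage under double negation is enough.
  ... | no x≁y = ⊥-elim (linkage large-x large-y λ L → linkage⇒not-cleavable x y x≁y L cleavable)

theorem17 : ∀ {n : ℕ} (G : PlaneGraph n) → PlaneGraph.KConnected G 4 →
    (PlaneGraph.Cleavable G ⇔ PlaneGraph.AtMostOneLargeFace G)
theorem17 G 4-connected = mk⇔
  (TwoLargeFaces.at-most-one-large-face (PlaneGraph.map G) (record { euler = PlaneGraph.euler G }) (record { 4-connected = 4-connected }))
  (NearTriangulation.cleavable (PlaneGraph.map G) (record { euler = PlaneGraph.euler G }) (record { 4-connected = 4-connected }))
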